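{- There exists a positive integer $n_0$ such that for every integer $n \geq n_0$, among all triangle-free graphs on $n$ vertices, the balanced complete bipartite graph $K_{\lfloor n/2\rfloor, \lceil n/2\rceil}$ is the triangle-free graph with the largest number of cycles.
   Context: Graphs are finite and simple. A cycle in a graph is a subgraph isomorphic to $C_m$ for some $m\geq 3$; the number of cycles of a graph $G$ is the number of such subgraphs. A graph is triangle-free if it contains no cycle of length $3$. $K_{a,b}$ denotes the complete bipartite graph with parts of sizes $a$ and $b$. -}

module Defs where

open import Data.Nat using (ℕ; zero; suc; _+_; _<_; _≤_; _<ᵇ_; _/_)
open import Data.Nat.DivMod using (_mod_)
open import Data.Fin using (Fin; toℕ)
open import Data.Bool using (Bool; true; false; _xor_)
open import Data.Vec using (Vec; lookup)
open import Data.List using (List)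
open import Data.List.Membership.Propositional using (_∈_)
open import Data.List.Relation.Unary.Unique.Propositional using (Unique)
open import Data.Product using (Σ; ∃; _×_; _,_)
open import Data.Sum using (_⊎_)
open import Data.Empty using (⊥)
open import Relation.Nullary using (¬_)
open import Relation.Binary.PropositionalEquality using (_≡_; _≢_)
open import Function.Bundles using (_⇔_; _↔_; Inverse)
open import Function.Definitions using (Injective)

record Graph (n : ℕ) : Set where
  field
    adj    : Fin n → Fin n → Bool
    sym    : ∀ i j → adj i j ≡ adj j i
    irrefl : ∀ i → adj i i ≡ false
open Graph public

-- Edge sets on Fin n, encoded first-order as Boolean adjacency matrices.
EdgeSet : ℕ → Set
EdgeSet n = Vec (Vec Bool n) n

_∋ₑ_,_ : ∀ {n} → EdgeSet n → Fin n → Fin n → Set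
H ∋ₑ i , j = lookup (lookup H i) j ≡ true

cnext : ∀ {m} → Fin (suc m) → Fin (suc m)
cnext {m} k = suc (toℕ k) mod (suc m)

IsCycleOfLength : ∀ {n} (p : ℕ) → EdgeSet n → Set
IsCycleOfLength {n} p H =
  Σ (Fin (3 + p) → Fin n) λ f →
    Injective _≡_ _≡_ f ×
    (∀ i j → (H ∋ₑ i , j) ⇔
       (∃ λ k → (i ≡ f k × j ≡ f (cnext k)) ⊎ (j ≡ f k × i ≡ f (cnext k))))

IsCycle : ∀ {n} → EdgeSet n → Set
IsCycle H = ∃ λ p → IsCycleOfLength p H

_⊆G_ : ∀ {n} → EdgeSet n → Graph n → Set
H ⊆G G = ∀ i j → H ∋ₑ i , j → adj G i j ≡ true

NumCycles : ∀ {n} → Graph n → ℕ → Set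
NumCycles {n} G c =
  Σ (List (EdgeSet n)) λ L →
    Unique L × Data.List.length L ≡ c ×
    (∀ H → (H ∈ L) ⇔ (H ⊆G G × IsCycle H))
  where import Data.List

TriangleFree : ∀ {n} → Graph n → Set
TriangleFree {n} G =
  ¬ (Σ (Fin n) λ i → Σ (Fin n) λ j → Σ (Fin n) λ k →
       i ≢ j × j ≢ k × i ≢ k ×
       adj G i j ≡ true × adj G j k ≡ true × adj G i k ≡ true)

_≅_ : ∀ {n} → Graph n → Graph n → Set
_≅_ {n} G H = Σ (Fin n ↔ Fin n) λ σ →
  ∀ i j → adj G i j ≡ adj H (Inverse.to σ i) (Inverse.to σ j)

inA : (n : ℕ) → Fin n → Bool
inA n i = toℕ i <ᵇ (n / 2)

private
  xor-self : ∀ b → b xor b ≡ false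
  xor-self false = Relation.Binary.PropositionalEquality.refl
  xor-self true  = Relation.Binary.PropositionalEquality.refl

  xor-comm : ∀ a b → a xor b ≡ b xor a
  xor-comm false false = Relation.Binary.PropositionalEquality.refl
  xor-comm false true  = Relation.Binary.PropositionalEquality.refl
  xor-comm true  false = Relation.Binary.PropositionalEquality.refl
  xor-comm true  true  = Relation.Binary.PropositionalEquality.refl

balancedBipartite : (n : ℕ) → Graph n
balancedBipartite n = record
  { adj    = λ i j → inA n i xor inA n j
  ; sym    = λ i j → xor-comm (inA n i) (inA n j)
  ; irrefl = λ i → xor-self (inA n i)
  }

-- Delete a vertex v and induct: the cycles through v correspond to pairs of neighbours x, y of v
-- together with an x–y path in the rest.  In a triangle-free graph the two-step continuations of a
-- path at x number at most a(r − a), where r vertices are still available and a of them are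
-- neighbours of x, because a neighbour of a neighbour of x is not a neighbour of x.  Iterating
-- bounds the number of x–y paths, for even n exactly by the number in a balanced complete bipartite
-- graph and for odd n by at most 3/2 of it.  Either some vertex has degree at most 2n/5, and then
-- the cycles through it are outnumbered by those through a vertex of the balanced complete
-- bipartite graph (as 3/2 · (4/5)² < 1), or the graph is bipartite (Andrásfai), where the
-- comparison with complete bipartite graphs is explicit.

module Submission where

-- The ratio 3/2 is settled at four inner vertices, where `pathBound` is 9 and `gainQuotient` is 6.
-- Two-step counting alone would give 10, and 5/3 · (4/5)² is already above 1; hence the separate
-- analysis of paths with four inner vertices. From there on both quantities follow one recursion,
-- which cannot raise the ratio. All counts are doubled: a cycle through a vertex belongs to an
-- unordered pair of its neighbours, while products such as `d (d − 1)` count ordered pairs. A graph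
-- is processed as a list of vertices, each cycle being counted at its first vertex in the list. Any
-- ordering of the vertices bounds the number of cycles, so the induction may choose the order of
-- deletion as it proceeds. For uniqueness it is enough that one loss is strict: at the first
-- deletion, in the sizes of the two parts, or at one missing edge. The link to `NumCycles` is a
-- choice of one closed walk for every cycle, fixed by the order of the list; a cyclic list without
-- repetitions is recovered from its edge set up to starting point and direction.

open import Defs renaming (sym to adj-sym)
open import Data.Bool using (Bool; true; false; if_then_else_; _∧_; not; _xor_)
open import Data.Bool.Properties using (¬-not; ∧-comm) renaming (_≟_ to _≟ᵇ_)
open import Data.Fin using (Fin; zero; suc; toℕ; cast)
open import Data.Fin.Permutation using (Permutation; _∘ₚ_; cast-id; _⟨$⟩ʳ_)
open import Data.Fin.Properties using (toℕ-fromℕ<; toℕ-injective; toℕ<n; cast-involutive) renaming (_≟_ to _≟ᶠ_)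
open import Data.List
  using (List; []; _∷_; length; map; _++_; _∷ʳ_; reverse; tabulate; lookup; allFin; replicate; initLast; _∷ʳ′_)
open import Data.List.Membership.DecPropositional using (_∈?_)
open import Data.List.Membership.Propositional using (_∈_; _∉_; lose; find)
open import Data.List.Membership.Propositional.Properties
  using (∈-++⁺ˡ; ∈-++⁺ʳ; ∈-++⁻; ∈-∃++; ∈-map⁺; ∈-map⁻; ∈-lookup; ∈-allFin)
open import Data.List.Properties
  using (length-map; length-++; ++-assoc; ∷-injective; ∷ʳ-injective; reverse-++; unfold-reverse; reverse-involutive;
         length-tabulate; lookup-tabulate; tabulate-lookup)
open import Data.List.Relation.Binary.Permutation.Homogeneous using (onIndices)
open import Data.List.Relation.Binary.Permutation.Propositional
  using (_↭_; prep; swap; ↭-refl; ↭-sym; ↭-trans; ↭⇒↭ₛ)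
import Data.List.Relation.Binary.Permutation.Propositional as Perm
open import Data.List.Relation.Binary.Permutation.Propositional.Properties
  using (↭-length; ∈-resp-↭; ++-comm; ↭-reverse; shift)
import Data.List.Relation.Binary.Permutation.Setoid.Properties as Permutationₛ
open import Data.List.Relation.Unary.All using (All; []; _∷_)
import Data.List.Relation.Unary.All as All
open import Data.List.Relation.Unary.AllPairs using ([]; _∷_)
open import Data.List.Relation.Unary.Any using (Any; here; there; any?)
open import Data.List.Relation.Unary.Unique.Propositional using (Unique)
import Data.List.Relation.Unary.Unique.Propositional.Properties as Unique
open import Data.Nat
open import Data.Nat.DivMod using (n%n≡0; m<n⇒m%n≡m; m/n≡1+[m∸n]/n)
open import Data.Nat.ListAction using (sum)
open import Data.Nat.Properties
open import Data.Nat.Tactic.RingSolver using (solve-∀)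
open import Data.Product using (Σ; ∃; ∃₂; _×_; _,_; proj₁; proj₂)
open import Data.Sum using (_⊎_; inj₁; inj₂; [_,_]′)
import Data.Sum as Sum
import Data.Vec as Vec
import Data.Vec.Properties as Vec
open import Function using (_∘_; id)
open import Function.Bundles using (Equivalence; mk⇔)
open import Relation.Binary.PropositionalEquality
  using (_≡_; _≢_; refl; sym; trans; cong; cong₂; subst; subst₂; setoid; module ≡-Reasoning)
open import Relation.Nullary using (Dec; yes; no; does; ¬_; contradiction)
open import Relation.Nullary.Decidable using (map′; _×-dec_; _⊎-dec_; dec-true)

-- Cycles of complete bipartite graphs

-- With (b)ⱼ = b (b − 1) ⋯ (b − j + 1), Φ b a = Σ_{j ≥ 1} (b)ⱼ (a)ⱼ and Θ b a = Σ_{j ≥ 1} (b)ⱼ₊₁ (a)ⱼ.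
-- Θ b a is twice the number of cycles of K_{a+1,b} through a given vertex of the first part.
Φ : ℕ → ℕ → ℕ
Φ zero    a       = 0
Φ (suc b) zero    = 0
Φ (suc b) (suc a) = suc b * suc a * (1 + Φ b a)

Θ : ℕ → ℕ → ℕ
Θ zero    a       = 0
Θ (suc b) zero    = 0
Θ (suc b) (suc a) = suc a * suc b * (b + Θ b a)

Φ-sym : ∀ b a → Φ b a ≡ Φ a b
Φ-sym zero    zero    = refl
Φ-sym zero    (suc a) = refl
Φ-sym (suc b) zero    = refl
Φ-sym (suc b) (suc a) = cong₂ (λ m j → m * (1 + j)) (*-comm (suc b) (suc a)) (Φ-sym b a)

-- Termwise, `(b + 1)ⱼ₊₁ = (b + 1) (b)ⱼ`.
Θ≡Φ : ∀ b a → Θ (suc b) a ≡ suc b * Φ b a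
Θ≡Φ b       zero    = sym (trans (cong (suc b *_) (Φ-sym b 0)) (*-zeroʳ (suc b)))
Θ≡Φ zero    (suc a) = *-zeroʳ (suc a * 1)
Θ≡Φ (suc b) (suc a) = trans (cong (λ e → suc a * suc (suc b) * (suc b + e)) (Θ≡Φ b a)) (lem a b (Φ b a))
  where
  lem : ∀ a b j → suc a * suc (suc b) * (suc b + suc b * j) ≡ suc (suc b) * (suc b * suc a * (1 + j))
  lem = solve-∀

-- Since `(b)ⱼ₊₁ = (b − j) (b)ⱼ`, corresponding terms of `Θ b a` and `Θ a b` carry the factors
-- `b − j` and `a − j`, so `Θ b a − Θ a b = (b − a) Φ b a`; written here without subtraction.
exchange : ∀ b a → b * Φ b a + Θ a b ≡ a * Φ b a + Θ b a
exchange zero    zero    = refl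
exchange zero    (suc a) = sym (trans (+-identityʳ (suc a * 0)) (*-zeroʳ (suc a)))
exchange (suc b) zero    = cong (_+ 0) (*-zeroʳ b)
exchange (suc b) (suc a) = begin
  suc b * (m * (1 + j)) + suc b * suc a * (a + Θ a b)  ≡⟨ lhs a b j (Θ a b) ⟩
  m * (1 + a + b + j + (b * j + Θ a b))
      ≡⟨ cong (λ z → m * (1 + a + b + j + z)) (exchange b a) ⟩
  m * (1 + a + b + j + (a * j + Θ b a))                ≡⟨ rhs a b j (Θ b a) ⟩
  suc a * (m * (1 + j)) + suc a * suc b * (b + Θ b a)  ∎
  where
  open ≡-Reasoning
  j = Φ b a
  m = suc b * suc a
  lhs : ∀ a b j e → suc b * (suc b * suc a * (1 + j)) + suc b * suc a * (a + e) ≡ suc b * suc a *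
      (1 + a + b + j + (b * j + e))
  lhs = solve-∀
  rhs : ∀ a b j e → suc b * suc a * (1 + a + b + j + (a * j + e)) ≡ suc a * (suc b * suc a * (1 + j)) + suc a
      * suc b * (b + e)
  rhs = solve-∀

-- κ a b is twice the number of cycles of K_{a,b}.
κ : ℕ → ℕ → ℕ
κ zero    b = 0
κ (suc a) b = κ a b + Θ b a

-- One vertex is added to each part of `K_{a,b}`, and the two orders of doing so create equally many
-- cycles. This lets `κ`, a recursion on its first argument, grow in the second as well.
Θ-diff : ∀ b a → Θ (suc b) a + Θ a b ≡ Θ (suc a) b + Θ b a
Θ-diff b a = begin
  Θ (suc b) a + Θ a b              ≡⟨ cong (_+ Θ a b) (Θ≡Φ b a) ⟩
  Φ b a + b * Φ b a + Θ a b        ≡⟨ +-assoc (Φ b a) _ _ ⟩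
  Φ b a + (b * Φ b a + Θ a b)      ≡⟨ cong (Φ b a +_) (exchange b a) ⟩
  Φ b a + (a * Φ b a + Θ b a)      ≡⟨ +-assoc (Φ b a) _ _ ⟨
  suc a * Φ b a + Θ b a            ≡⟨ cong (λ j → suc a * j + Θ b a) (Φ-sym b a) ⟩
  suc a * Φ a b + Θ b a            ≡⟨ cong (_+ Θ b a) (Θ≡Φ a b) ⟨
  Θ (suc a) b + Θ b a              ∎
  where open ≡-Reasoning

κ-suc : ∀ a b → κ a (suc b) ≡ κ a b + Θ a b
κ-suc zero    b = refl
κ-suc (suc a) b = begin
  κ a (suc b) + Θ (suc b) a        ≡⟨ cong (_+ Θ (suc b) a) (κ-suc a b) ⟩
  κ a b + Θ a b + Θ (suc b) a      ≡⟨ +-assoc (κ a b) _ _ ⟩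
  κ a b + (Θ a b + Θ (suc b) a)
      ≡⟨ cong (κ a b +_) (trans (+-comm (Θ a b) _) (trans (Θ-diff b a) (+-comm (Θ (suc a) b) _))) ⟩
  κ a b + (Θ b a + Θ (suc a) b)    ≡⟨ +-assoc (κ a b) _ _ ⟨
  κ a b + Θ b a + Θ (suc a) b      ∎
  where open ≡-Reasoning

κ-zeroʳ : ∀ a → κ a 0 ≡ 0
κ-zeroʳ zero    = refl
κ-zeroʳ (suc a) = trans (+-identityʳ (κ a 0)) (κ-zeroʳ a)

κ-sym : ∀ a b → κ a b ≡ κ b a
κ-sym zero    b = sym (κ-zeroʳ b)
κ-sym (suc a) b = trans (cong (_+ Θ b a) (κ-sym a b)) (sym (κ-suc b a))

Θ-mono : ∀ {b p} → b ≤ p → Θ b p ≤ Θ p b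
Θ-mono {b} {p} b≤p = +-cancelˡ-≤ (b * Φ b p) _ _ (begin
  b * Φ b p + Θ b p  ≤⟨ +-monoˡ-≤ (Θ b p) (*-monoˡ-≤ (Φ b p) b≤p) ⟩
  p * Φ b p + Θ b p  ≡⟨ exchange b p ⟨
  b * Φ b p + Θ p b  ∎)
  where open ≤-Reasoning

Θ-mono-< : ∀ {b p} → 0 < b → b < p → Θ b p < Θ p b
Θ-mono-< {suc b} {suc p} _ b<p = +-cancelˡ-< (suc b * j) _ _ (begin-strict
  suc b * j + Θ (suc b) (suc p)  <⟨ +-monoˡ-< (Θ (suc b) (suc p)) (*-monoˡ-< j b<p) ⟩
  suc p * j + Θ (suc b) (suc p)  ≡⟨ exchange (suc b) (suc p) ⟨
  suc b * j + Θ (suc p) (suc b)  ∎)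
  where
  open ≤-Reasoning
  j = Φ (suc b) (suc p)

-- Both graphs arise from `K_{p,b}` by one new vertex, which lies on more cycles when it joins the
-- smaller part.
κ-step : ∀ {b p} → b ≤ p → κ (suc p) b ≤ κ p (suc b)
κ-step {b} {p} b≤p = ≤-trans (+-monoʳ-≤ (κ p b) (Θ-mono b≤p)) (≤-reflexive (sym (κ-suc p b)))

κ-step-< : ∀ {b p} → 0 < b → b < p → κ (suc p) b < κ p (suc b)
κ-step-< {b} {p} 0<b b<p = <-≤-trans (+-monoʳ-< (κ p b) (Θ-mono-< 0<b b<p)) (≤-reflexive (sym (κ-suc p b)))

-- The vertex added to the balanced graph on `n` vertices joins the smaller part and so sees the
-- larger one.
gain : ℕ → ℕ
gain n = Θ ⌈ n /2⌉ ⌊ n /2⌋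

κ-bal : ℕ → ℕ
κ-bal zero    = 0
κ-bal (suc n) = κ-bal n + gain n

κ-bal≡ : ∀ n → κ-bal n ≡ κ ⌈ n /2⌉ ⌊ n /2⌋
κ-bal≡ zero = refl
κ-bal≡ (suc n) = cong (_+ gain n) (trans (κ-bal≡ n) (κ-sym ⌈ n /2⌉ ⌊ n /2⌋))

-- Each vertex moved to the smaller part lowers the difference `d` of the sizes by two, until the
-- parts are balanced.
κ-max′ : ∀ d b → κ (d + b) b ≤ κ-bal (d + b + b)
κ-max′ zero b = ≤-reflexive (sym (trans (κ-bal≡ (b + b)) (cong₂ κ (sym (n≡⌈n+n/2⌉ b)) (sym (n≡⌊n+n/2⌋ b)))))
κ-max′ (suc zero) b =
    ≤-reflexive (sym (trans (κ-bal≡ (suc (b + b)))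
    (cong₂ κ (cong suc (sym (n≡⌊n+n/2⌋ b))) (sym (n≡⌈n+n/2⌉ b)))))
κ-max′ (suc (suc d)) b = begin
  κ (suc (suc d) + b) b             ≤⟨ κ-step (m≤n+m b (suc d)) ⟩
  κ (suc d + b) (suc b)             ≡⟨ cong (λ a → κ a (suc b)) (+-suc d b) ⟨
  κ (d + suc b) (suc b)             ≤⟨ κ-max′ d (suc b) ⟩
  κ-bal (d + suc b + suc b)         ≡⟨ cong κ-bal (eq d b) ⟩
  κ-bal (suc (suc d) + b + b)       ∎
  where
  open ≤-Reasoning
  eq : ∀ d b → d + suc b + suc b ≡ suc (suc d) + b + b
  eq = solve-∀

κ-max-<′ : ∀ d b → 2 ≤ d → 4 ≤ d + b + b → κ (d + b) b < κ-bal (d + b + b)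
κ-max-<′ (suc (suc d)) (suc b) _ _ = begin-strict
  κ (suc (suc d) + suc b) (suc b)             <⟨ κ-step-< z<s (s≤s (m≤n+m (suc b) d)) ⟩
  κ (suc d + suc b) (suc (suc b))             ≡⟨ cong (λ a → κ a (suc (suc b))) (+-suc d (suc b)) ⟨
  κ (d + suc (suc b)) (suc (suc b))             ≤⟨ κ-max′ d (suc (suc b)) ⟩
  κ-bal (d + suc (suc b) + suc (suc b))         ≡⟨ cong κ-bal (eq d b) ⟩
  κ-bal (suc (suc d) + suc b + suc b)       ∎
  where
  open ≤-Reasoning
  eq : ∀ d b → d + suc (suc b) + suc (suc b) ≡ suc (suc d) + suc b + suc b
  eq = solve-∀
κ-max-<′ (suc zero) _ (s≤s ()) _
κ-max-<′ (suc (suc zero)) zero _ (s≤s (s≤s ()))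
κ-max-<′ (suc (suc (suc zero))) zero _ (s≤s (s≤s (s≤s ())))
κ-max-<′ (suc (suc (suc (suc d)))) zero _ _ = begin-strict
  -- The first move only turns an edgeless graph into a star, with no cycle on either side; the
  -- second move is strict, as there are at least four vertices.
  κ (4 + d + 0) 0        ≤⟨ κ-step {0} {3 + d + 0} z≤n ⟩
  κ (3 + d + 0) 1        ≡⟨ cong (λ e → κ (3 + e) 1) (+-identityʳ d) ⟩
  κ (3 + d) 1            <⟨ κ-step-< {1} {2 + d} z<s (s≤s (s≤s z≤n)) ⟩
  κ (2 + d) 2            ≡⟨ cong (λ e → κ e 2) (+-comm 2 d) ⟩
  κ (d + 2) 2            ≤⟨ κ-max′ d 2 ⟩
  κ-bal (d + 2 + 2)      ≡⟨ cong κ-bal (eq d) ⟩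
  κ-bal (4 + d + 0 + 0)  ∎
  where
  open ≤-Reasoning
  eq : ∀ d → d + 2 + 2 ≡ 4 + d + 0 + 0
  eq = solve-∀

κ-max : ∀ a b → κ a b ≤ κ-bal (a + b)
κ-max a b with ≤-total b a
... | inj₁ b≤a = subst (λ x → κ x b ≤ κ-bal (x + b)) (m∸n+n≡m b≤a) (κ-max′ (a ∸ b) b)
... | inj₂ a≤b = subst₂ _≤_ (κ-sym b a) (cong κ-bal (+-comm b a))
                   (subst (λ x → κ x a ≤ κ-bal (x + a)) (m∸n+n≡m a≤b) (κ-max′ (b ∸ a) a))

half : ∀ d b → d < 2 → b ≡ ⌊ d + b + b /2⌋
half zero b _ = n≡⌊n+n/2⌋ b
half (suc zero) b _ = n≡⌈n+n/2⌉ b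
half (suc (suc d)) b (s≤s (s≤s ()))

κ-max-unique′ : ∀ d b → 4 ≤ d + b + b → κ-bal (d + b + b) ≤ κ (d + b) b → b ≡ ⌊ d + b + b /2⌋
κ-max-unique′ d b 4≤n max with d <? 2
... | yes d<2 = half d b d<2
... | no d≮2 = contradiction max (<⇒≱ (κ-max-<′ d b (≮⇒≥ d≮2) 4≤n))

κ-max-unique : ∀ a b → 4 ≤ a + b → κ-bal (a + b) ≤ κ a b → b ≡ ⌊ a + b /2⌋ ⊎ a ≡ ⌊ a + b /2⌋
κ-max-unique a b 4≤n max with ≤-total b a
... | inj₁ b≤a = inj₁ (subst (λ x → 4 ≤ x + b → κ-bal (x + b) ≤ κ x b → b ≡ ⌊ x + b /2⌋)
                   (m∸n+n≡m b≤a) (κ-max-unique′ (a ∸ b) b) 4≤n max)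
... | inj₂ a≤b = inj₂ (trans (subst (λ x → 4 ≤ x + a → κ-bal (x + a) ≤ κ x a → a ≡ ⌊ x + a /2⌋)
                   (m∸n+n≡m a≤b) (κ-max-unique′ (b ∸ a) a)
                     (subst (4 ≤_) (+-comm a b) 4≤n)
                     (subst₂ _≤_ (cong κ-bal (+-comm a b)) (κ-sym a b) max))
                   (cong ⌊_/2⌋ (+-comm b a)))

-- Bounds the paths between two vertices of a triangle-free graph with r possible inner
-- vertices.  The recursion alone would give 10 at r = 4, which is too much for odd n.
pathBound : ℕ → ℕ
pathBound 0 = 1
pathBound 1 = 1
pathBound 2 = 2
pathBound 3 = 4
pathBound 4 = 9
pathBound (suc (suc r@(suc (suc (suc _))))) = suc ⌈ r /2⌉ * (1 + suc ⌊ r /2⌋ * pathBound r)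

-- The recursion of pathBound, started so that gain (2 + r) = (1 + ⌈r/2⌉) (1 + ⌊r/2⌋) gainQuotient r.
gainQuotient : ℕ → ℕ
gainQuotient 0 = 0
gainQuotient 1 = 1
gainQuotient (suc (suc r)) = suc ⌈ r /2⌉ * (1 + suc ⌊ r /2⌋ * gainQuotient r)

pathBound-pos : ∀ r → 0 < pathBound r
pathBound-pos 0 = z<s
pathBound-pos 1 = z<s
pathBound-pos 2 = z<s
pathBound-pos 3 = z<s
pathBound-pos 4 = z<s
pathBound-pos (suc (suc (suc (suc (suc _))))) = z<s

-- At odd arguments the two agree; at 4 the ratio is exactly 9 to 6. If `w / g` is at most 3/2, so
-- is `(1 + q w) / (1 + q g)`, and the recursion preserves the bound.
pathBound≤gainQuotient : ∀ r → 2 * pathBound (3 + r) ≤ 3 * gainQuotient (3 + r)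
pathBound≤gainQuotient 0 = ≤ᵇ⇒≤ 8 12 _
pathBound≤gainQuotient 1 = ≤-refl
pathBound≤gainQuotient (suc (suc r)) = begin
  2 * (p * (1 + q * pathBound (3 + r)))     ≡⟨ lhs p q (pathBound (3 + r)) ⟩
  p * (2 + q * (2 * pathBound (3 + r)))
      ≤⟨ *-monoʳ-≤ p (+-mono-≤ (n≤1+n 2) (*-monoʳ-≤ q (pathBound≤gainQuotient r))) ⟩
  p * (3 + q * (3 * gainQuotient (3 + r)))     ≡⟨ rhs p q (gainQuotient (3 + r)) ⟩
  3 * (p * (1 + q * gainQuotient (3 + r)))     ∎
  where
  open ≤-Reasoning
  p = suc ⌈ 3 + r /2⌉
  q = suc ⌊ 3 + r /2⌋
  lhs : ∀ p q w → 2 * (p * (1 + q * w)) ≡ p * (2 + q * (2 * w))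
  lhs = solve-∀
  rhs : ∀ p q w → p * (3 + q * (3 * w)) ≡ 3 * (p * (1 + q * w))
  rhs = solve-∀

Φ≡gainQuotient : ∀ r → Φ ⌈ r /2⌉ (suc ⌊ r /2⌋) ≡ suc ⌊ r /2⌋ * gainQuotient r
Φ≡gainQuotient 0 = refl
Φ≡gainQuotient 1 = refl
Φ≡gainQuotient (suc (suc r)) =
    trans (cong (λ j → suc p * suc (suc q) * (1 + j)) (Φ≡gainQuotient r)) (lem p q (gainQuotient r))
  where
  p = ⌈ r /2⌉
  q = ⌊ r /2⌋
  lem : ∀ p q b → suc p * suc (suc q) * (1 + suc q * b) ≡ suc (suc q) * (suc p * (1 + suc q * b))
  lem = solve-∀

gain≡gainQuotient : ∀ r → gain (2 + r) ≡ suc ⌈ r /2⌉ * suc ⌊ r /2⌋ * gainQuotient r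
gain≡gainQuotient r =
    trans (Θ≡Φ ⌈ r /2⌉ (suc ⌊ r /2⌋))
    (trans (cong (suc ⌈ r /2⌉ *_) (Φ≡gainQuotient r))
    (sym (*-assoc (suc ⌈ r /2⌉) (suc ⌊ r /2⌋) (gainQuotient r))))

halves-square : ∀ r → r * r ≤ 1 + 4 * (⌈ r /2⌉ * ⌊ r /2⌋)
halves-square 0 = z≤n
halves-square 1 = ≤-refl
halves-square (suc (suc r)) = begin
  (2 + r) * (2 + r)                       ≡⟨ lhs r ⟩
  r * r + 4 * r + 4                       ≤⟨ +-monoˡ-≤ 4 (+-monoˡ-≤ (4 * r) (halves-square r)) ⟩
  1 + 4 * (p * q) + 4 * r + 4             ≡⟨ cong (λ s → 1 + 4 * (p * q) + 4 * s + 4) (⌊n/2⌋+⌈n/2⌉≡n r) ⟨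
  1 + 4 * (p * q) + 4 * (q + p) + 4       ≡⟨ rhs p q ⟩
  1 + 4 * (suc p * suc q)                 ∎
  where
  open ≤-Reasoning
  p = ⌈ r /2⌉
  q = ⌊ r /2⌋
  lhs : ∀ r → (2 + r) * (2 + r) ≡ r * r + 4 * r + 4
  lhs = solve-∀
  rhs : ∀ p q → 1 + 4 * (p * q) + 4 * (q + p) + 4 ≡ 1 + 4 * (suc p * suc q)
  rhs = solve-∀

-- The factors 3 and 2 are the ratio of `pathBound` to `gainQuotient`. With `d = e + 1` the degree
-- condition reads `5e + 3 ≤ 2m`, and `(5e + 3)²` exceeds `24 e (e + 1) + 4`: the coefficients 24
-- and 25 are 3/2 · (4/5)² = 24/25, and the 4 pays for odd `m` in `halves-square`.
pairs-bound : ∀ d m → 2 ≤ m → 5 * d ≤ 2 * (1 + m) → 3 * (d * (d ∸ 1)) < 2 * (⌈ m /2⌉ * ⌊ m /2⌋)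
pairs-bound zero    (suc (suc m)) _ _ = z<s
pairs-bound zero    (suc zero) (s≤s ()) _
pairs-bound (suc e) m _ 5d≤ = *-cancelˡ-< 8 _ _ (+-cancelˡ-< 4 _ _ (begin-strict
  4 + 8 * (3 * (suc e * e))     <⟨ m≤m+n _ (e * e + 6 * e + 4) ⟩
  suc (4 + 8 * (3 * (suc e * e))) + (e * e + 6 * e + 4)  ≡⟨ e₁ e ⟩
  (5 * e + 3) * (5 * e + 3)     ≤⟨ *-mono-≤ 5e+3≤2m 5e+3≤2m ⟩
  2 * m * (2 * m)               ≡⟨ e₂ m ⟩
  4 * (m * m)                   ≤⟨ *-monoʳ-≤ 4 (halves-square m) ⟩
  4 * (1 + 4 * (⌈ m /2⌉ * ⌊ m /2⌋))       ≡⟨ e₃ (⌈ m /2⌉ * ⌊ m /2⌋) ⟩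
  4 + 8 * (2 * (⌈ m /2⌉ * ⌊ m /2⌋)) ∎))
  where
  open ≤-Reasoning
  e₀ : ∀ e → 2 + (5 * e + 3) ≡ 5 * suc e
  e₀ = solve-∀
  e₁ : ∀ e → suc (4 + 8 * (3 * (suc e * e))) + (e * e + 6 * e + 4) ≡ (5 * e + 3) * (5 * e + 3)
  e₁ = solve-∀
  e₂ : ∀ m → 2 * m * (2 * m) ≡ 4 * (m * m)
  e₂ = solve-∀
  e₃ : ∀ x → 4 * (1 + 4 * x) ≡ 4 + 8 * (2 * x)
  e₃ = solve-∀
  5e+3≤2m : 5 * e + 3 ≤ 2 * m
  5e+3≤2m = +-cancelˡ-≤ 2 _ _ (subst₂ _≤_ (sym (e₀ e)) (*-distribˡ-+ 2 1 m) 5d≤)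

gainQuotient-pos : ∀ r → 0 < gainQuotient (suc r)
gainQuotient-pos zero = z<s
gainQuotient-pos (suc zero) = z<s
gainQuotient-pos (suc (suc r)) = z<s

-- The left side will bound twice the number of cycles through a vertex with `d` neighbours among
-- `n` others: ordered pairs of neighbours times paths with `n − 2` inner vertices available. At
-- `n = 4`, `d = 2` both sides are 4, so strictness starts at 5.
gain-bound-< : ∀ d n → 5 ≤ n → 5 * d ≤ 2 * (1 + n) → d * (d ∸ 1) * pathBound (n ∸ 2) < gain n
gain-bound-< d (suc (suc (suc (suc (suc r))))) 5≤n 5d≤ = *-cancelˡ-< 2 _ _ (begin-strict
  2 * (d * (d ∸ 1) * pathBound (3 + r))    ≡⟨ e₁ (d * (d ∸ 1)) (pathBound (3 + r)) ⟩
  d * (d ∸ 1) * (2 * pathBound (3 + r))    ≤⟨ *-monoʳ-≤ (d * (d ∸ 1)) (pathBound≤gainQuotient r) ⟩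
  d * (d ∸ 1) * (3 * gainQuotient (3 + r))    ≡⟨ e₂ (d * (d ∸ 1)) (gainQuotient (3 + r)) ⟩
  3 * (d * (d ∸ 1)) * gainQuotient (3 + r)
      <⟨ *-monoˡ-< (gainQuotient (3 + r)) {{>-nonZero (gainQuotient-pos (2 + r))}}
      (pairs-bound d (5 + r) (s≤s (s≤s z≤n)) 5d≤) ⟩
  2 * (p * q) * gainQuotient (3 + r)          ≡⟨ *-assoc 2 (p * q) (gainQuotient (3 + r)) ⟩
  2 * (p * q * gainQuotient (3 + r))          ≡⟨ cong (2 *_) (gain≡gainQuotient (3 + r)) ⟨
  2 * gain (5 + r)                 ∎)
  where
  open ≤-Reasoning
  p = ⌈ 5 + r /2⌉
  q = ⌊ 5 + r /2⌋
  e₁ : ∀ x y → 2 * (x * y) ≡ x * (2 * y)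
  e₁ = solve-∀
  e₂ : ∀ x y → x * (3 * y) ≡ 3 * x * y
  e₂ = solve-∀
gain-bound-< d (suc (suc (suc (suc zero)))) (s≤s (s≤s (s≤s (s≤s ())))) _
gain-bound-< d (suc (suc (suc zero))) (s≤s (s≤s (s≤s ()))) _
gain-bound-< d (suc (suc zero)) (s≤s (s≤s ())) _
gain-bound-< d (suc zero) (s≤s ()) _

-- Below five vertices, rounding the degree condition leaves `d ≤ 1`, hence no pair of neighbours,
-- except at `n = 4`, where `d = 2` gives equality.
gain-bound : ∀ d n → 5 * d ≤ 2 * (1 + n) → d * (d ∸ 1) * pathBound (n ∸ 2) ≤ gain n
gain-bound d n 5d≤ with 5 ≤? n
... | yes 5≤n = <⇒≤ (gain-bound-< d n 5≤n 5d≤)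
... | no 5≰n = small d n (≰⇒> 5≰n) 5d≤
  where
  at-most : ∀ d k → 5 * d ≤ 5 * k + 4 → d ≤ k
  at-most d k 5d≤ = s≤s⁻¹ (*-cancelˡ-< 5 d (suc k) (≤-trans (s≤s 5d≤) (≤-reflexive (lem k))))
    where
    lem : ∀ k → suc (5 * k + 4) ≡ 5 * suc k
    lem = solve-∀
  small : ∀ d n → n < 5 → 5 * d ≤ 2 * (1 + n) → d * (d ∸ 1) * pathBound (n ∸ 2) ≤ gain n
  small d 0 _ h with at-most d 0 (≤-trans h (≤ᵇ⇒≤ 2 4 _))
  ... | z≤n = z≤n
  small d 1 _ h with at-most d 0 h
  ... | z≤n = z≤n
  small d 2 _ h with at-most d 1 (≤-trans h (≤ᵇ⇒≤ 6 9 _))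
  ... | z≤n = z≤n
  ... | s≤s z≤n = z≤n
  small d 3 _ h with at-most d 1 (≤-trans h (≤ᵇ⇒≤ 8 9 _))
  ... | z≤n = z≤n
  ... | s≤s z≤n = z≤n
  small d 4 _ h = *-mono-≤ {d * (d ∸ 1)} {2} {2} {2} (*-mono-≤ d≤2 (∸-monoˡ-≤ 1 d≤2)) ≤-refl
    where d≤2 = at-most d 2 (≤-trans h (≤ᵇ⇒≤ 10 14 _))
  small d (suc (suc (suc (suc (suc n))))) (s≤s (s≤s (s≤s (s≤s (s≤s ()))))) _

-- Both claims say that a product with fixed sum is largest when balanced: `a + a q` is `a (1 + q)`,
-- and `P` differs by at most one from `Q` and from `1 + Q` alike.
product-bound : ∀ {P Q} a q → Q ≤ P → P ≤ suc Q → a + q ≡ P + Q → a * q ≤ P * Q × a + a * q ≤ P + P * Q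
product-bound {P} {Q} a q Q≤P P≤1+Q eq with a ≤? Q
... | yes a≤Q = aq≤PQ , +-mono-≤ (≤-trans a≤Q Q≤P) aq≤PQ
  where
  i = Q ∸ a
  Q≡ : Q ≡ a + i
  Q≡ = sym (m+[n∸m]≡n a≤Q)
  q≡ : q ≡ P + i
  q≡ = +-cancelˡ-≡ a q (P + i) (trans eq (trans (cong (P +_) Q≡) (lem P a i)))
    where
    lem : ∀ P a i → P + (a + i) ≡ a + (P + i)
    lem = solve-∀
  open ≤-Reasoning
  aq≤PQ : a * q ≤ P * Q
  aq≤PQ = begin
    a * q            ≡⟨ cong (a *_) q≡ ⟩
    a * (P + i)      ≡⟨ *-distribˡ-+ a P i ⟩
    a * P + a * i    ≤⟨ +-mono-≤ (≤-reflexive (*-comm a P)) (*-monoˡ-≤ i (≤-trans a≤Q Q≤P)) ⟩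
    P * a + P * i    ≡⟨ *-distribˡ-+ P a i ⟨
    P * (a + i)      ≡⟨ cong (P *_) Q≡ ⟨
    P * Q            ∎
... | no a≰Q = ≤-trans (m≤n+m (a * q) i) i+aq≤PQ , (begin
    a + a * q          ≡⟨ cong (_+ a * q) a≡ ⟩
    P + i + a * q      ≡⟨ +-assoc P i (a * q) ⟩
    P + (i + a * q)    ≤⟨ +-monoʳ-≤ P i+aq≤PQ ⟩
    P + P * Q          ∎)
  where
  open ≤-Reasoning
  i = a ∸ P
  a≡ : a ≡ P + i
  a≡ = sym (m+[n∸m]≡n (≤-trans P≤1+Q (≰⇒> a≰Q)))
  Q≡ : Q ≡ q + i
  Q≡ = +-cancelˡ-≡ P Q (q + i) (trans (sym eq) (trans (cong (_+ q) a≡) (lem P q i)))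
    where
    lem : ∀ P q i → P + i + q ≡ P + (q + i)
    lem = solve-∀
  key : ∀ i → Q ≡ q + i → i * suc q ≤ i * P
  key zero _ = z≤n
  key (suc i) e = *-monoʳ-≤ (suc i)
      (≤-trans (≤-trans (s≤s (m≤m+n q i)) (≤-reflexive (trans (sym (+-suc q i)) (sym e)))) Q≤P)
  i+aq≤PQ : i + a * q ≤ P * Q
  i+aq≤PQ = begin
    i + a * q            ≡⟨ cong (λ a → i + a * q) a≡ ⟩
    i + (P + i) * q      ≡⟨ lem P q i ⟩
    P * q + i * suc q    ≤⟨ +-monoʳ-≤ (P * q) (key i Q≡) ⟩
    P * q + i * P        ≡⟨ lem′ P q i ⟩
    P * (q + i)          ≡⟨ cong (P *_) Q≡ ⟨
    P * Q                ∎
    where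
    lem : ∀ P q i → i + (P + i) * q ≡ P * q + i * suc q
    lem = solve-∀
    lem′ : ∀ P q i → P * q + i * P ≡ P * (q + i)
    lem′ = solve-∀

-- The two left sides are the two cases of `two-step`. As `w` is positive, `a (1 + q w)` splits into
-- `a + a q` and `a q (w − 1)`, each of which `product-bound` controls.
two-step-bound : ∀ r w a q → 0 < w → a + q ≡ 2 + r →
  a * (1 + q * w) ≤ suc ⌈ r /2⌉ * (1 + suc ⌊ r /2⌋ * w) ×
      1 + a * (q * w) ≤ suc ⌈ r /2⌉ * (1 + suc ⌊ r /2⌋ * w)
two-step-bound r (suc w) a q _ eq = (begin
    a * (1 + q * suc w)             ≡⟨ lem a q w ⟩
    (a + a * q) + a * q * w         ≤⟨ +-mono-≤ (proj₂ b) (*-monoˡ-≤ w (proj₁ b)) ⟩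
    (P + P * Q) + P * Q * w         ≡⟨ lem P Q w ⟨
    P * (1 + Q * suc w)             ∎) , (begin
    1 + a * (q * suc w)             ≡⟨ cong suc (*-assoc a q (suc w)) ⟨
    1 + a * q * suc w               ≤⟨ +-mono-≤ (s≤s (z≤n {⌈ r /2⌉})) (*-monoˡ-≤ (suc w) (proj₁ b)) ⟩
    P + P * Q * suc w               ≡⟨ lem′ P Q (suc w) ⟨
    P * (1 + Q * suc w)             ∎)
  where
  open ≤-Reasoning
  P = suc ⌈ r /2⌉
  Q = suc ⌊ r /2⌋
  lem : ∀ a q w → a * (1 + q * suc w) ≡ (a + a * q) + a * q * w
  lem = solve-∀
  lem′ : ∀ a q w → a * (1 + q * w) ≡ a + a * q * w
  lem′ = solve-∀
  ceil≤ : ∀ r → ⌈ r /2⌉ ≤ suc ⌊ r /2⌋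
  ceil≤ 0 = z≤n
  ceil≤ 1 = ≤-refl
  ceil≤ (suc (suc r)) = s≤s (ceil≤ r)
  b = product-bound a q (s≤s (⌊n/2⌋≤⌈n/2⌉ r)) (s≤s (ceil≤ r))
        (trans eq (cong suc (trans (cong suc (sym (trans (+-comm ⌈ r /2⌉ _) (⌊n/2⌋+⌈n/2⌉≡n r))))
            (sym (+-suc ⌈ r /2⌉ ⌊ r /2⌋)))))

-- Counting paths and cycles

⟦_⟧ : Bool → ℕ
⟦ true ⟧ = 1
⟦ false ⟧ = 0

⟦⟧≤1 : ∀ b → ⟦ b ⟧ ≤ 1
⟦⟧≤1 true = ≤-refl
⟦⟧≤1 false = z≤n

module _ {A : Set} where

  count : (A → Bool) → List A → ℕ
  count p []       = 0
  count p (x ∷ xs) = ⟦ p x ⟧ + count p xs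

  -- Pick S u r: removing the occurrence u from S leaves r.  Pick₂ S a b r: removing a and a later b.
  data Pick : List A → A → List A → Set where
    here  : ∀ {x xs} → Pick (x ∷ xs) x xs
    there : ∀ {x xs u r} → Pick xs u r → Pick (x ∷ xs) u (x ∷ r)

  data Pick₂ : List A → A → A → List A → Set where
    here  : ∀ {x xs y r} → Pick xs y r → Pick₂ (x ∷ xs) x y r
    there : ∀ {x xs a b r} → Pick₂ xs a b r → Pick₂ (x ∷ xs) a b (x ∷ r)

  sum₁ : List A → (A → List A → ℕ) → ℕ
  sum₁ []       f = 0
  sum₁ (x ∷ xs) f = f x xs + sum₁ xs (λ u r → f u (x ∷ r))

  sum₂ : List A → (A → A → List A → ℕ) → ℕ
  sum₂ []       f = 0
  sum₂ (x ∷ xs) f = sum₁ xs (f x) + sum₂ xs (λ a b r → f a b (x ∷ r))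

  sum₁-mono : ∀ S {f g} → (∀ {u r} → Pick S u r → f u r ≤ g u r) → sum₁ S f ≤ sum₁ S g
  sum₁-mono []       h = z≤n
  sum₁-mono (x ∷ xs) h = +-mono-≤ (h here) (sum₁-mono xs (h ∘ there))

  sum₁-cong : ∀ S {f g} → (∀ {u r} → Pick S u r → f u r ≡ g u r) → sum₁ S f ≡ sum₁ S g
  sum₁-cong []       h = refl
  sum₁-cong (x ∷ xs) h = cong₂ _+_ (h here) (sum₁-cong xs (h ∘ there))

  sum₂-mono : ∀ S {f g} → (∀ {a b r} → Pick₂ S a b r → f a b r ≤ g a b r) → sum₂ S f ≤ sum₂ S g
  sum₂-mono []       h = z≤n
  sum₂-mono (x ∷ xs) h = +-mono-≤ (sum₁-mono xs (h ∘ here)) (sum₂-mono xs (h ∘ there))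

  sum₂-cong : ∀ S {f g} → (∀ {a b r} → Pick₂ S a b r → f a b r ≡ g a b r) → sum₂ S f ≡ sum₂ S g
  sum₂-cong []       h = refl
  sum₂-cong (x ∷ xs) h = cong₂ _+_ (sum₁-cong xs (h ∘ here)) (sum₂-cong xs (h ∘ there))

  sum₁-const : ∀ S p c → sum₁ S (λ u r → if p u then c else 0) ≡ count p S * c
  sum₁-const []       p c = refl
  sum₁-const (x ∷ xs) p c with p x
  ... | true  = cong (c +_) (sum₁-const xs p c)
  ... | false = sum₁-const xs p c

  sum₂-const : ∀ S p c → 2 * sum₂ S (λ a b r → if p a ∧ p b then c else 0) ≡ count p S * (count p S ∸ 1) * c
  sum₂-const []       p c = refl
  sum₂-const (x ∷ xs) p c with p x
  ... | true = begin
    2 * (sum₁ xs (λ b r → if p b then c else 0) + S₂)  ≡⟨ cong (λ s → 2 * (s + S₂)) (sum₁-const xs p c) ⟩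
    2 * (d * c + S₂)                                    ≡⟨ *-distribˡ-+ 2 (d * c) S₂ ⟩
    2 * (d * c) + 2 * S₂                                ≡⟨ cong (2 * (d * c) +_) (sum₂-const xs p c) ⟩
    2 * (d * c) + d * (d ∸ 1) * c                       ≡⟨ lem d c ⟩
    suc d * d * c                                       ∎
    where
    open ≡-Reasoning
    d = count p xs
    S₂ = sum₂ xs (λ a b r → if p a ∧ p b then c else 0)
    lem : ∀ d c → 2 * (d * c) + d * (d ∸ 1) * c ≡ suc d * d * c
    lem zero    c = refl
    lem (suc d) c = lem′ d c
      where
      lem′ : ∀ d c → 2 * (suc d * c) + suc d * d * c ≡ suc (suc d) * suc d * c
      lem′ = solve-∀
  ... | false = trans (cong (λ s → 2 * (s + S₂))
      (trans (sum₁-const xs (λ _ → false) 0) (*-zeroʳ (count (λ _ → false) xs))))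
                      (sum₂-const xs p c)
    where S₂ = sum₂ xs (λ a b r → if p a ∧ p b then c else 0)

  count-pick : ∀ p {S u r} → Pick S u r → count p S ≡ ⟦ p u ⟧ + count p r
  count-pick p here = refl
  count-pick p (there {x} {u = u} {r} i) =
      trans (cong (⟦ p x ⟧ +_) (count-pick p i)) (lem ⟦ p x ⟧ ⟦ p u ⟧ (count p r))
    where
    lem : ∀ a b c → a + (b + c) ≡ b + (a + c)
    lem = solve-∀

  Pick⇒↭ : ∀ {S u r} → Pick S u r → S ↭ u ∷ r
  Pick⇒↭ here = ↭-refl
  Pick⇒↭ (there i) = ↭-trans (prep _ (Pick⇒↭ i)) (swap _ _ ↭-refl)

  length-pick : ∀ {S u r} → Pick S u r → length S ≡ suc (length r)
  length-pick here = refl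
  length-pick (there i) = cong suc (length-pick i)

  length-pick-pick : ∀ {S u r z r′ n} → Pick S u r → Pick r z r′ → length S ≡ 2 + n → length r′ ≡ n
  length-pick-pick i j len =
      suc-injective (suc-injective (trans (sym (trans (length-pick i) (cong suc (length-pick j)))) len))

  count-pick₂ : ∀ p {S a b r} → Pick₂ S a b r → count p S ≡ ⟦ p a ⟧ + (⟦ p b ⟧ + count p r)
  count-pick₂ p (here {x} i) = cong (⟦ p x ⟧ +_) (count-pick p i)
  count-pick₂ p (there {x} {a = a} {b} {r} i) =
      trans (cong (⟦ p x ⟧ +_) (count-pick₂ p i)) (lem ⟦ p x ⟧ ⟦ p a ⟧ ⟦ p b ⟧ (count p r))
    where
    lem : ∀ a b c d → a + (b + (c + d)) ≡ b + (c + (a + d))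
    lem = solve-∀

  length-pick₂ : ∀ {S a b r} → Pick₂ S a b r → length S ≡ 2 + length r
  length-pick₂ (here i) = cong suc (length-pick i)
  length-pick₂ (there i) = cong suc (length-pick₂ i)

  count-mono : ∀ {p q : A → Bool} S → (∀ x → p x ≡ true → q x ≡ true) → count p S ≤ count q S
  count-mono [] h = z≤n
  count-mono {p} {q} (x ∷ S) h with p x in px
  ... | false = ≤-trans (count-mono S h) (m≤n+m _ ⟦ q x ⟧)
  ... | true rewrite h x px = s≤s (count-mono S h)

  count-not : ∀ p S → count p S + count (not ∘ p) S ≡ length S
  count-not p [] = refl
  count-not p (x ∷ S) with p x
  ... | true = cong suc (count-not p S)
  ... | false = trans (+-suc _ _) (cong suc (count-not p S))

module Paths {V : Set} (adj : V → V → Bool) where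

  -- The inner vertices come from S; the fuel is length S in every use.
  pathCount : ℕ → List V → V → V → ℕ
  pathCount zero    S x y = ⟦ adj x y ⟧
  pathCount (suc k) S x y = ⟦ adj x y ⟧ + sum₁ S (λ u r → if adj x u then pathCount k r u y else 0)

  -- The two neighbours are taken in the order of the list, so each cycle through `v` is counted in
  -- one direction only.
  thruCount : V → List V → ℕ
  thruCount v S = sum₂ S (λ x y r → if adj v x ∧ adj v y then pathCount (length r) r x y else 0)

  -- The order of the list is the order of deletion: a cycle is counted when the first of its
  -- vertices is removed.
  cycleCount : List V → ℕ
  cycleCount []      = 0
  cycleCount (v ∷ S) = thruCount v S + cycleCount S

  thruCount-bound : ∀ v S c →
      (∀ {x y r} → Pick₂ S x y r → adj v x ≡ true → adj v y ≡ true → pathCount (length r) r x y ≤ c) →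
               2 * thruCount v S ≤ count (adj v) S * (count (adj v) S ∸ 1) * c
  thruCount-bound v S c h =
      ≤-trans (*-monoʳ-≤ 2 (sum₂-mono S λ {x} {y} i → step x y i)) (≤-reflexive (sum₂-const S (adj v) c))
    where
    step : ∀ x y {r} → Pick₂ S x y r →
        (if adj v x ∧ adj v y then pathCount (length r) r x y else 0) ≤ (if adj v x ∧ adj v y then c else 0)
    step x y i with adj v x in vx | adj v y in vy
    ... | true  | true  = h i vx vy
    ... | true  | false = z≤n
    ... | false | _     = z≤n

-- Paths in triangle-free graphs

module TriangleFreePaths {V : Set} (adj : V → V → Bool)
  (symm : ∀ x y → adj x y ≡ true → adj y x ≡ true)
  (tri  : ∀ x y z → adj x y ≡ true → adj y z ≡ true → adj x z ≡ false) where

  open Paths adj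

  no-edge : ∀ {u a b} → adj u a ≡ true → adj u b ≡ true → adj a b ≡ false
  no-edge {u} {a} {b} ua ub = tri a u b (symm u a ua) ub

  second-step-≤ : ∀ k {w} x {u S r} y → adj x u ≡ true → Pick S u r →
      (∀ {z r′} → Pick r z r′ → pathCount k r′ z y ≤ w) →
          sum₁ r (λ z r′ → if adj u z then pathCount k r′ z y else 0) ≤ count (not ∘ adj x) S * w
  second-step-≤ k {w} x {u} {S} {r} y xu i h = begin
    sum₁ r (λ z r′ → if adj u z then pathCount k r′ z y else 0)  ≤⟨ sum₁-mono r (λ {z} i → bound z i) ⟩
    sum₁ r (λ z r′ → if adj u z then w else 0)           ≡⟨ sum₁-const r (adj u) w ⟩
    count (adj u) r * w
        ≤⟨ *-monoˡ-≤ w (count-mono r (λ z uz → cong not (tri x u z xu uz))) ⟩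
    count (not ∘ adj x) r * w                            ≤⟨ *-monoˡ-≤ w (m≤n+m _ ⟦ not (adj x u) ⟧) ⟩
    (⟦ not (adj x u) ⟧ + count (not ∘ adj x) r) * w      ≡⟨ cong (_* w) (count-pick (not ∘ adj x) i) ⟨
    count (not ∘ adj x) S * w                            ∎
    where
    open ≤-Reasoning
    bound : ∀ z {r′} → Pick r z r′ → (if adj u z then pathCount k r′ z y else 0) ≤ (if adj u z then w else 0)
    bound z i with adj u z
    ... | true = h i
    ... | false = z≤n

  first-step-≤ : ∀ k {c} x y S → (∀ {u r} → adj x u ≡ true → Pick S u r → pathCount k r u y ≤ c) →
          sum₁ S (λ u r → if adj x u then pathCount k r u y else 0) ≤ count (adj x) S * c
  first-step-≤ k {c} x y S h =
      ≤-trans (sum₁-mono S λ {u} i → bound u i) (≤-reflexive (sum₁-const S (adj x) c))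
    where
    bound : ∀ u {r} → Pick S u r → (if adj x u then pathCount k r u y else 0) ≤ (if adj x u then c else 0)
    bound u i with adj x u in xu
    ... | true = h xu i
    ... | false = z≤n

  -- If `xy` is an edge, no neighbour of `x` is adjacent to `y`: the single path of length one then
  -- replaces all paths of length two.
  two-step : ∀ k w x y S → (∀ {u r z r′} → Pick S u r → Pick r z r′ → pathCount k r′ z y ≤ w) →
    pathCount (2 + k) S x y ≤ 1 + count (adj x) S * (count (not ∘ adj x) S * w) × adj x y ≡ true ⊎
    pathCount (2 + k) S x y ≤ count (adj x) S * (1 + count (not ∘ adj x) S * w) × adj x y ≡ false
  two-step k w x y S h with adj x y in xy
  ... | true = inj₁ (s≤s
      (first-step-≤ (suc k) x y S
      (λ {u} xu i → +-mono-≤ (≤-reflexive (cong ⟦_⟧ (tri u x y (symm x u xu) xy)))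
      (second-step-≤ k x y xu i (h i)))) , refl)
  ... | false = inj₂ (first-step-≤ (suc k) x y S
      (λ {u} xu i → +-mono-≤ (⟦⟧≤1 (adj u y)) (second-step-≤ k x y xu i (h i))) , refl)

  pathCount-step : ∀ r {w} x y S → 0 < w → length S ≡ 2 + r → (∀ x S → length S ≡ r → pathCount r S x y ≤ w) →
           pathCount (2 + r) S x y ≤ suc ⌈ r /2⌉ * (1 + suc ⌊ r /2⌋ * w)
  pathCount-step r {w} x y S w>0 len h =
      [ (λ b → ≤-trans (proj₁ b) (proj₂ tb)) , (λ b → ≤-trans (proj₁ b) (proj₁ tb)) ]′
    (two-step r w x y S (λ i j → h _ _ (length-pick-pick i j len)))
    where tb = two-step-bound r w (count (adj x) S) (count (not ∘ adj x) S) w>0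
              (trans (count-not (adj x) S) len)

  pathCount-0 : ∀ x y S → pathCount 0 S x y ≤ 1
  pathCount-0 x y S = ⟦⟧≤1 (adj x y)

  pathCount-2 : ∀ x y S → length S ≡ 2 → pathCount 2 S x y ≤ 2
  pathCount-2 x y S len = pathCount-step 0 x y S z<s len (λ x S _ → pathCount-0 x y S)

  -- The edge `xy` and the path through `s` together would form a triangle.
  pathCount-1 : ∀ x y S → length S ≡ 1 → pathCount 1 S x y ≤ 1
  pathCount-1 x y (s ∷ []) _ with adj x y in xy | adj x s in xs
  ... | true  | true  rewrite tri s x y (symm x s xs) xy = ≤-refl
  ... | true  | false = ≤-refl
  ... | false | true  = ≤-trans (≤-reflexive (+-identityʳ _)) (⟦⟧≤1 (adj s y))
  ... | false | false = z≤n

  -- With these three non-edges only the path `z t y` is possible. Both orders of the inner vertices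
  -- occur, since picking keeps the order of the list.
  pathCount-2-≤1 : ∀ {z y} s t → adj z y ≡ false → adj s y ≡ false → adj z s ≡ false →
           pathCount 2 (s ∷ t ∷ []) z y ≤ 1 × pathCount 2 (t ∷ s ∷ []) z y ≤ 1
  pathCount-2-≤1 {z} {y} s t zy sy zs rewrite zy | sy | zs with adj z t | adj t y | adj t s
  ... | false | _     | _     = z≤n , z≤n
  ... | true  | true  | true  = ≤-refl , ≤-refl
  ... | true  | true  | false = ≤-refl , ≤-refl
  ... | true  | false | true  = z≤n , z≤n
  ... | true  | false | false = z≤n , z≤n

  -- Neighbours of `u` are adjacent neither to `y` nor to each other. If `r` contains two of them,
  -- each starts at most one path to `y`; a single one starts at most two.
  common-neighbour-≤3 : ∀ {u y} r → adj u y ≡ true → length r ≡ 3 → count (adj u) r ≤ 2 →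
                     sum₁ r (λ z r′ → if adj u z then pathCount 2 r′ z y else 0) ≤ 3
  common-neighbour-≤3 {u} {y} (a ∷ b ∷ c ∷ []) uy _ few with adj u a in ua | adj u b in ub | adj u c in uc
  ... | true | true | true = contradiction few (<⇒≱ ≤-refl)
  ... | true | true | false =
      ≤-trans (+-mono-≤ (proj₁ (pathCount-2-≤1 b c (no-edge ua uy) (no-edge ub uy) (no-edge ua ub)))
                                        (≤-trans (≤-reflexive (+-identityʳ _))
                                            (proj₁ (pathCount-2-≤1 a c (no-edge ub uy) (no-edge ua uy)
                                            (no-edge ub ua))))) (n≤1+n 2)
  ... | true | false | true =
      ≤-trans (+-mono-≤ (proj₂ (pathCount-2-≤1 c b (no-edge ua uy) (no-edge uc uy) (no-edge ua uc)))
                                        (≤-trans (≤-reflexive (+-identityʳ _))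
                                            (proj₁ (pathCount-2-≤1 a b (no-edge uc uy) (no-edge ua uy)
                                            (no-edge uc ua))))) (n≤1+n 2)
  ... | false | true | true =
      ≤-trans (+-mono-≤ (proj₂ (pathCount-2-≤1 c a (no-edge ub uy) (no-edge uc uy) (no-edge ub uc)))
                                        (≤-trans (≤-reflexive (+-identityʳ _))
                                            (proj₂ (pathCount-2-≤1 b a (no-edge uc uy) (no-edge ub uy)
                                            (no-edge uc ub))))) (n≤1+n 2)
  ... | true | false | false =
      ≤-trans (≤-reflexive (+-identityʳ _)) (≤-trans (pathCount-2 a y (b ∷ c ∷ []) refl) (n≤1+n 2))
  ... | false | true | false =
      ≤-trans (≤-reflexive (+-identityʳ _)) (≤-trans (pathCount-2 b y (a ∷ c ∷ []) refl) (n≤1+n 2))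
  ... | false | false | true =
      ≤-trans (≤-reflexive (+-identityʳ _)) (≤-trans (pathCount-2 c y (a ∷ b ∷ []) refl) (n≤1+n 2))
  ... | false | false | false = z≤n

  -- The two-step bound exceeds 9 only when `xy` is not an edge and `x` has two neighbours and two
  -- non-neighbours in `S`. It then allows each neighbour `u` one direct edge to `y` and four longer
  -- paths, ten in all. These exclude each other: if `uy` is an edge, at most three longer paths
  -- remain, so each `u` has at most four and the total is 8.
  pathCount-4 : ∀ x y S → length S ≡ 4 → pathCount 4 S x y ≤ 9
  pathCount-4 x y S len with two-step 2 2 x y S
      (λ {u} {r} {z} {r′} i j → pathCount-2 z y r′ (length-pick-pick i j len))
  ... | inj₁ (b , _) = ≤-trans b
      (joined (count (adj x) S) (count (not ∘ adj x) S) (trans (count-not (adj x) S) len))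
    where
    joined : ∀ a q → a + q ≡ 4 → 1 + a * (q * 2) ≤ 9
    joined 0 q refl = ≤ᵇ⇒≤ 1 9 _
    joined 1 q refl = ≤ᵇ⇒≤ 7 9 _
    joined 2 q refl = ≤ᵇ⇒≤ 9 9 _
    joined 3 q refl = ≤ᵇ⇒≤ 7 9 _
    joined 4 q refl = ≤ᵇ⇒≤ 1 9 _
  ... | inj₂ (b , xy) = apart _ _ refl refl (trans (count-not (adj x) S) len)
    where
    open ≤-Reasoning
    per-u : count (not ∘ adj x) S ≡ 2 → ∀ {u r} → adj x u ≡ true → Pick S u r → pathCount 3 r u y ≤ 4
    per-u two {u} {r} xu i with adj u y in uy
    ... | false = ≤-trans
        (second-step-≤ 2 x y xu i (λ {z} {r′} j → pathCount-2 z y r′ (length-pick-pick i j len)))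
                          (≤-reflexive (cong (_* 2) two))
    ... | true = s≤s (common-neighbour-≤3 r uy (suc-injective (trans (sym (length-pick i)) len)) (begin
      count (adj u) r              ≤⟨ count-mono r (λ z uz → cong not (tri x u z xu uz)) ⟩
      count (not ∘ adj x) r        ≤⟨ m≤n+m _ ⟦ not (adj x u) ⟧ ⟩
      ⟦ not (adj x u) ⟧ + count (not ∘ adj x) r  ≡⟨ count-pick (not ∘ adj x) i ⟨
      count (not ∘ adj x) S        ≡⟨ two ⟩
      2                            ∎))
    apart : ∀ a q → count (adj x) S ≡ a → count (not ∘ adj x) S ≡ q → a + q ≡ 4 → pathCount 4 S x y ≤ 9
    apart 0 q ea eq refl =
        ≤-trans b (≤-trans (≤-reflexive (cong₂ (λ a q → a * (1 + q * 2)) ea eq)) (≤ᵇ⇒≤ 0 9 _))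
    apart 1 q ea eq refl =
        ≤-trans b (≤-trans (≤-reflexive (cong₂ (λ a q → a * (1 + q * 2)) ea eq)) (≤ᵇ⇒≤ 7 9 _))
    apart 3 q ea eq refl =
        ≤-trans b (≤-trans (≤-reflexive (cong₂ (λ a q → a * (1 + q * 2)) ea eq)) (≤ᵇ⇒≤ 9 9 _))
    apart 4 q ea eq refl =
        ≤-trans b (≤-trans (≤-reflexive (cong₂ (λ a q → a * (1 + q * 2)) ea eq)) (≤ᵇ⇒≤ 4 9 _))
    apart 2 q ea eq refl = begin
      pathCount 4 S x y
          ≡⟨ cong (λ e → ⟦ e ⟧ + sum₁ S (λ u r → if adj x u then pathCount 3 r u y else 0)) xy ⟩
      sum₁ S (λ u r → if adj x u then pathCount 3 r u y else 0) ≤⟨ first-step-≤ 3 x y S (per-u eq) ⟩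
      count (adj x) S * 4           ≡⟨ cong (_* 4) ea ⟩
      8                             ≤⟨ n≤1+n 8 ⟩
      9                             ∎

  pathCount-bound : ∀ r x y S → length S ≡ r → pathCount r S x y ≤ pathBound r
  pathCount-bound 0 x y S len = pathCount-0 x y S
  pathCount-bound 1 x y S len = pathCount-1 x y S len
  pathCount-bound 2 x y S len = pathCount-2 x y S len
  pathCount-bound 3 x y S len = pathCount-step 1 x y S z<s len (λ x → pathCount-1 x y)
  pathCount-bound 4 x y S len = pathCount-4 x y S len
  pathCount-bound (suc (suc r@(suc (suc (suc _))))) x y S len =
      pathCount-step r x y S (pathBound-pos r) len (λ x → pathCount-bound r x y)

-- A vertex of low degree, or a bipartition

module _ {A : Set} where

  Pick-∈ : ∀ {S : List A} {u} → u ∈ S → ∃ (Pick S u)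
  Pick-∈ (here refl) = _ , here
  Pick-∈ (there i) with Pick-∈ i
  ... | r , p = _ , there p

  All-pick : ∀ {P : A → Set} {S u r} → Pick S u r → All P S → P u × All P r
  All-pick here (px ∷ pxs) = px , pxs
  All-pick (there i) (px ∷ pxs) with All-pick i pxs
  ... | pu , pr = pu , px ∷ pr

  All-pick₂ : ∀ {P : A → Set} {S a b r} → Pick₂ S a b r → All P S → P a × P b × All P r
  All-pick₂ (here i) (px ∷ pxs) with All-pick i pxs
  ... | pu , pr = px , pu , pr
  All-pick₂ (there i) (px ∷ pxs) with All-pick₂ i pxs
  ... | pa , pb , pr = pa , pb , px ∷ pr

  count-↭ : ∀ (p : A → Bool) {xs ys} → xs ↭ ys → count p xs ≡ count p ys
  count-↭ p Perm.refl = refl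
  count-↭ p (prep x s) = cong (⟦ p x ⟧ +_) (count-↭ p s)
  count-↭ p (swap x y s) = trans (cong (λ c → ⟦ p x ⟧ + (⟦ p y ⟧ + c)) (count-↭ p s)) (lem ⟦ p x ⟧ ⟦ p y ⟧ _)
    where
    lem : ∀ a b c → a + (b + c) ≡ b + (a + c)
    lem = solve-∀
  count-↭ p (Perm.trans s t) = trans (count-↭ p s) (count-↭ p t)

  counts : List (A → Bool) → List A → ℕ
  counts ps L = sum (map (λ p → count p L) ps)

  counts-bound : ∀ ps c L → (∀ {z} → z ∈ L → sum (map (λ p → ⟦ p z ⟧) ps) ≤ c) → counts ps L ≤ length L * c
  counts-bound ps c [] h = ≤-reflexive (zeros ps)
    where
    zeros : ∀ ps → counts ps [] ≡ 0
    zeros [] = refl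
    zeros (p ∷ ps) = zeros ps
  counts-bound ps c (z ∷ L) h =
      ≤-trans (≤-reflexive (split ps)) (+-mono-≤ (h (here refl)) (counts-bound ps c L (h ∘ there)))
    where
    split : ∀ ps → counts ps (z ∷ L) ≡ sum (map (λ p → ⟦ p z ⟧) ps) + counts ps L
    split [] = refl
    split (p ∷ ps) = trans (cong (⟦ p z ⟧ + count p L +_) (split ps)) (lem ⟦ p z ⟧ (count p L) _ _)
      where
      lem : ∀ a b c d → a + b + (c + d) ≡ a + c + (b + d)
      lem = solve-∀

pentagon : ∀ p q r s t → p ∧ q ≡ false → q ∧ r ≡ false → r ∧ s ≡ false → s ∧ t ≡ false → t ∧ p ≡ false →
           ⟦ p ⟧ + (⟦ q ⟧ + (⟦ r ⟧ + (⟦ s ⟧ + (⟦ t ⟧ + 0)))) ≤ 2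
pentagon true  false true  false false _ _ _ _ _ = ≤-refl
pentagon true  false false true  false _ _ _ _ _ = ≤-refl
pentagon true  false false false false _ _ _ _ _ = s≤s z≤n
pentagon false true  false true  false _ _ _ _ _ = ≤-refl
pentagon false true  false false true  _ _ _ _ _ = ≤-refl
pentagon false true  false false false _ _ _ _ _ = s≤s z≤n
pentagon false false true  false true  _ _ _ _ _ = ≤-refl
pentagon false false true  false false _ _ _ _ _ = s≤s z≤n
pentagon false false false true  false _ _ _ _ _ = s≤s z≤n
pentagon false false false false true  _ _ _ _ _ = s≤s z≤n
pentagon false false false false false _ _ _ _ _ = z≤n

disjoint₃ : ∀ p q r → p ∧ q ≡ false → q ∧ r ≡ false → r ∧ p ≡ false → ⟦ p ⟧ + (⟦ q ⟧ + (⟦ r ⟧ + 0)) ≤ 1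
disjoint₃ true  false false _ _ _ = ≤-refl
disjoint₃ false true  false _ _ _ = ≤-refl
disjoint₃ false false true  _ _ _ = ≤-refl
disjoint₃ false false false _ _ _ = z≤n

∧-true : ∀ {a b} → a ∧ b ≡ true → a ≡ true × b ≡ true
∧-true {true} {true} _ = refl , refl

xor-does : ∀ {P Q : Set} (p : Dec P) (q : Dec Q) → ¬ (P × Q) → ¬ (¬ P × ¬ Q) → does p xor does q ≡ true
xor-does (yes p) (no  q) _ _ = refl
xor-does (no  p) (yes q) _ _ = refl
xor-does (yes p) (yes q) h _ = contradiction (p , q) h
xor-does (no  p) (no  q) _ h = contradiction (p , q) h

module Dichotomy {V : Set} (adj : V → V → Bool)
  (symm : ∀ x y → adj x y ≡ true → adj y x ≡ true)
  (tri  : ∀ x y z → adj x y ≡ true → adj y z ≡ true → adj x z ≡ false) where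

  Proper : (V → Bool) → List V → Set
  Proper χ L = ∀ {x y} → x ∈ L → y ∈ L → adj x y ≡ true → χ x xor χ y ≡ true

  apart : ∀ {x y} → adj x y ≡ true → ∀ z → adj x z ∧ adj y z ≡ false
  apart {x} {y} xy z with adj y z in yz
  ... | true  = cong (_∧ true) (tri x y z xy yz)
  ... | false with adj x z
  ...   | true  = refl
  ...   | false = refl

  -- With `m = length L`, five such degrees add up to more than `2m` and three to more than `m`.
  -- Double counting over the vertices of `L` contradicts this as soon as each vertex is counted at
  -- most twice, respectively once.
  degree-sum : ∀ L vs → All (λ v → ¬ (5 * count (adj v) L ≤ 2 * length L)) vs →
               length vs * suc (2 * length L) ≤ 5 * counts (map adj vs) L
  degree-sum L [] [] = z≤n
  degree-sum L (v ∷ vs) (h ∷ hs) = ≤-trans (+-mono-≤ (≰⇒> h) (degree-sum L vs hs))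
    (≤-reflexive (sym (*-distribˡ-+ 5 (count (adj v) L) (counts (map adj vs) L))))

  Joined : List V → V → V → Set
  Joined L v x = Any (λ a → adj v a ∧ adj a x ≡ true) L

  joined? : ∀ L v x → Dec (Joined L v x)
  joined? L v x = any? (λ a → (adj v a ∧ adj a x) ≟ᵇ true) L

  -- If all degrees exceed 2/5, colour by having a common neighbour with v.  An edge inside the first
  -- class closes a walk of length five, on which every vertex has at most two neighbours; an edge
  -- inside the second gives three disjoint neighbourhoods.
  dichotomy : ∀ L → (∃ λ v → v ∈ L × 5 * count (adj v) L ≤ 2 * length L) ⊎ (∃ λ χ → Proper χ L)
  dichotomy [] = inj₂ ((λ _ → true) , λ ())
  dichotomy L@(v ∷ _) with any? (λ w → 5 * count (adj w) L ≤? 2 * length L) L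
  ... | yes low = inj₁ (find low)
  ... | no ¬low = inj₂ ((λ x → does (joined? L v x)) , λ {x} {y} x∈ y∈ xy →
      xor-does (joined? L v x) (joined? L v y) (not-both x∈ y∈ xy) (not-neither x∈ y∈ xy))
    where
    m = length L
    high : ∀ {w} → w ∈ L → ¬ (5 * count (adj w) L ≤ 2 * m)
    high w∈ low = ¬low (lose w∈ low)
    not-both : ∀ {x y} → x ∈ L → y ∈ L → adj x y ≡ true → ¬ (Joined L v x × Joined L v y)
    not-both {x} {y} x∈ y∈ xy (jx , jy) with find jx | find jy
    ... | a , a∈ , vax | b , b∈ , vby = contradiction sums (<⇒≱ (begin-strict
      5 * counts (map adj (v ∷ a ∷ x ∷ y ∷ b ∷ [])) L
          ≤⟨ *-monoʳ-≤ 5 (counts-bound (map adj (v ∷ a ∷ x ∷ y ∷ b ∷ [])) 2 L λ {z} _ →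
           pentagon (adj v z) (adj a z) (adj x z) (adj y z) (adj b z) (apart va z) (apart ax z) (apart xy z)
               (apart yb z) (apart bv z)) ⟩
      5 * (m * 2)                  <⟨ m<m+n (5 * (m * 2)) {5} z<s ⟩
      5 * (m * 2) + 5              ≡⟨ lem m ⟩
      5 * suc (2 * m)              ∎))
      where
      open ≤-Reasoning
      lem : ∀ m → 5 * (m * 2) + 5 ≡ 5 * suc (2 * m)
      lem = solve-∀
      va = proj₁ (∧-true vax)
      ax = proj₂ (∧-true vax)
      yb = symm b y (proj₂ (∧-true {adj v b} vby))
      bv = symm v b (proj₁ (∧-true vby))
      sums = degree-sum L (v ∷ a ∷ x ∷ y ∷ b ∷ [])
          (high (here refl) ∷ high a∈ ∷ high x∈ ∷ high y∈ ∷ high b∈ ∷ [])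
    not-neither : ∀ {x y} → x ∈ L → y ∈ L → adj x y ≡ true → ¬ (¬ Joined L v x × ¬ Joined L v y)
    not-neither {x} {y} x∈ y∈ xy (¬jx , ¬jy) = contradiction sums (<⇒≱ (begin-strict
      5 * counts (map adj (v ∷ x ∷ y ∷ [])) L
          ≤⟨ *-monoʳ-≤ 5 (counts-bound (map adj (v ∷ x ∷ y ∷ [])) 1 L λ {z} z∈ →
           disjoint₃ (adj v z) (adj x z) (adj y z) (unjoined ¬jx z∈) (apart xy z)
               (trans (∧-comm (adj y z) (adj v z)) (unjoined ¬jy z∈))) ⟩
      5 * (m * 1)                  <⟨ m<m+n (5 * (m * 1)) {m + 3} (≤-trans z<s (m≤n+m 3 m)) ⟩
      5 * (m * 1) + (m + 3)        ≡⟨ lem m ⟩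
      3 * suc (2 * m)              ∎))
      where
      open ≤-Reasoning
      lem : ∀ m → 5 * (m * 1) + (m + 3) ≡ 3 * suc (2 * m)
      lem = solve-∀
      unjoined : ∀ {w z} → ¬ Joined L v w → z ∈ L → adj v z ∧ adj w z ≡ false
      unjoined {w} {z} ¬j z∈ with adj v z in vz | adj w z in wz
      ... | false | _ = refl
      ... | true | false = refl
      ... | true | true = contradiction (lose z∈ (trans (cong (_∧ adj z w) vz) (symm w z wz))) ¬j
      sums = degree-sum L (v ∷ x ∷ y ∷ []) (high (here refl) ∷ high x∈ ∷ high y∈ ∷ [])

-- Bipartite graphs

-- Paths of a complete bipartite graph whose ends lie in the same part, respectively in different
-- parts; p and q count the inner vertices available in the part of the last vertex and in the other.
mutual
  sameSidePaths : ℕ → ℕ → ℕ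
  sameSidePaths p zero    = 0
  sameSidePaths p (suc q) = suc q * crossPaths p q

  crossPaths : ℕ → ℕ → ℕ
  crossPaths zero    q = 1
  crossPaths (suc p) q = 1 + suc p * sameSidePaths p q

sameSidePaths-pred : ∀ p q → q * crossPaths p (pred q) ≡ sameSidePaths p q
sameSidePaths-pred p zero    = refl
sameSidePaths-pred p (suc q) = refl

crossPaths-pred : ∀ p q → 1 + p * sameSidePaths (pred p) q ≡ crossPaths p q
crossPaths-pred zero    q = refl
crossPaths-pred (suc p) q = refl

crossPaths-pos : ∀ p q → 0 < crossPaths p q
crossPaths-pos zero q = z<s
crossPaths-pos (suc p) q = z<s

-- The cycles through a vertex as ordered pairs of distinct neighbours, from a part of size `b`,
-- times the paths between them, for which `b − 2` vertices of that part are left.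
Θ≡sameSidePaths : ∀ b a → b * (b ∸ 1) * sameSidePaths (b ∸ 2) a ≡ Θ b a
Θ≡sameSidePaths 0 a = refl
Θ≡sameSidePaths 1 zero = refl
Θ≡sameSidePaths 1 (suc a) = sym (*-zeroʳ (suc a * 1))
Θ≡sameSidePaths (suc (suc b)) zero = *-zeroʳ (suc (suc b) * suc b)
Θ≡sameSidePaths 2 (suc a) = lem a
  where
  lem : ∀ a → 2 * 1 * (suc a * 1) ≡ suc a * 2 * (1 + Θ 1 a)
  lem a rewrite sym (Θ≡sameSidePaths 1 a) = lem′ a
    where
    lem′ : ∀ a → 2 * 1 * (suc a * 1) ≡ suc a * 2 * (1 + 0)
    lem′ = solve-∀
Θ≡sameSidePaths (suc (suc (suc b))) (suc a) = begin
  suc (suc (suc b)) * suc (suc b) * (suc a * (1 + suc b * sameSidePaths b a))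
      ≡⟨ lem a b (sameSidePaths b a) ⟩
  suc a * suc (suc (suc b)) * (suc (suc b) + suc (suc b) * suc b * sameSidePaths b a)
      ≡⟨ cong (λ t → suc a * suc (suc (suc b)) * (suc (suc b) + t)) (Θ≡sameSidePaths (suc (suc b)) a) ⟩
  suc a * suc (suc (suc b)) * (suc (suc b) + Θ (suc (suc b)) a)  ∎
  where
  open ≡-Reasoning
  lem : ∀ a b m → suc (suc (suc b)) * suc (suc b) * (suc a * (1 + suc b * m)) ≡ suc a * suc (suc (suc b)) *
      (suc (suc b) + suc (suc b) * suc b * m)
  lem = solve-∀

xor-cancel : ∀ c {d} → c xor d ≡ true → d ≡ not c
xor-cancel true  {false} _ = refl
xor-cancel false {true}  _ = refl

xor-not : ∀ c {d} → c xor d ≡ true → not c xor d ≡ false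
xor-not true  {false} _ = refl
xor-not false {true}  _ = refl

module Bipartite {V : Set} (χ : V → Bool) where

  across : V → V → Bool
  across x y = χ x xor χ y

  open Paths across

  not-xor : ∀ c d → not c xor d ≡ true → d ≡ c
  not-xor true  true  _ = refl
  not-xor false false _ = refl

  xor-same : ∀ c → c xor c ≡ false
  xor-same true = refl
  xor-same false = refl

  xor-opp : ∀ c → not c xor c ≡ true
  xor-opp true = refl
  xor-opp false = refl

  -- Written with `xor` so that `opposite (χ v)` is definitionally the degree `count (across v)`,
  -- and `opposite false` is `count χ`. The vertices of colour `c` itself are counted by
  -- `opposite (not c)`.
  opposite : Bool → List V → ℕ
  opposite c = count (λ z → c xor χ z)

  if-cong : ∀ b {m n} → (b ≡ true → m ≡ n) → (if b then m else 0) ≡ (if b then n else 0)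
  if-cong true h = h refl
  if-cong false h = refl

  mutual
    -- Every step changes sides, so the count depends only on how many vertices of each colour
    -- remain; the picked vertex lowers one of the two numbers by one.
    pathCount-same : ∀ k S x y → length S ≡ k → χ x ≡ χ y →
        pathCount k S x y ≡ sameSidePaths (opposite (not (χ y)) S) (opposite (χ y) S)
    pathCount-same zero [] x y _ xy rewrite xy | xor-same (χ y) = refl
    pathCount-same (suc k) S x y len xy rewrite xy | xor-same (χ y) = begin
      sum₁ S (λ u r → if χ y xor χ u then pathCount k r u y else 0)
        ≡⟨ sum₁-cong S (λ {u} {r} i → if-cong (χ y xor χ u) (λ yu → step u r i yu)) ⟩
      sum₁ S (λ u r → if χ y xor χ u then crossPaths p (pred q) else 0)
        ≡⟨ sum₁-const S (λ u → χ y xor χ u) (crossPaths p (pred q)) ⟩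
      q * crossPaths p (pred q)   ≡⟨ sameSidePaths-pred p q ⟩
      sameSidePaths p q ∎
      where
      open ≡-Reasoning
      p = opposite (not (χ y)) S
      q = opposite (χ y) S
      step : ∀ u r → Pick S u r → χ y xor χ u ≡ true → pathCount k r u y ≡ crossPaths p (pred q)
      step u r i yu = trans
          (pathCount-opp k r u y (suc-injective (trans (sym (length-pick i)) len)) (xor-cancel (χ y) yu))
        (cong₂ crossPaths (sym
            (trans (count-pick _ i) (cong (λ b → ⟦ b ⟧ + opposite (not (χ y)) r) (xor-not (χ y) yu))))
                 (sym (cong pred (trans (count-pick _ i) (cong (λ b → ⟦ b ⟧ + opposite (χ y) r) yu)))))

    pathCount-opp : ∀ k S x y → length S ≡ k → χ x ≡ not (χ y) →
        pathCount k S x y ≡ crossPaths (opposite (not (χ y)) S) (opposite (χ y) S)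
    pathCount-opp zero [] x y _ xy rewrite xy | xor-opp (χ y) = refl
    pathCount-opp (suc k) S x y len xy rewrite xy | xor-opp (χ y) = trans (cong suc (begin
      sum₁ S (λ u r → if not (χ y) xor χ u then pathCount k r u y else 0)
        ≡⟨ sum₁-cong S (λ {u} {r} i → if-cong (not (χ y) xor χ u) (λ yu → step u r i yu)) ⟩
      sum₁ S (λ u r → if not (χ y) xor χ u then sameSidePaths (pred p) q else 0)
        ≡⟨ sum₁-const S (λ u → not (χ y) xor χ u) (sameSidePaths (pred p) q) ⟩
      p * sameSidePaths (pred p) q   ∎)) (crossPaths-pred p q)
      where
      open ≡-Reasoning
      p = opposite (not (χ y)) S
      q = opposite (χ y) S
      step : ∀ u r → Pick S u r → not (χ y) xor χ u ≡ true → pathCount k r u y ≡ sameSidePaths (pred p) q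
      step u r i yu = trans
          (pathCount-same k r u y (suc-injective (trans (sym (length-pick i)) len)) (not-xor (χ y) (χ u) yu))
        (cong₂ sameSidePaths (sym
            (cong pred (trans (count-pick _ i) (cong (λ b → ⟦ b ⟧ + opposite (not (χ y)) r) yu))))
                 (sym (trans (count-pick _ i)
                     (cong (λ b → ⟦ b ⟧ + opposite (χ y) r)
                     (trans (cong (χ y xor_) (not-xor (χ y) (χ u) yu)) (xor-same (χ y)))))))

  pathCount-pair : ∀ v {S x y r} → Pick₂ S x y r → across v x ≡ true → across v y ≡ true →
           pathCount (length r) r x y ≡ sameSidePaths (opposite (χ v) S ∸ 2) (opposite (not (χ v)) S)
  pathCount-pair v {S} {x} {y} {r} i vx vy =
      trans (pathCount-same (length r) r x y refl (trans (xor-cancel (χ v) vx) (sym (xor-cancel (χ v) vy))))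
    (cong₂ sameSidePaths
      (trans (cong (λ c → opposite (not c) r) (xor-cancel (χ v) vy))
          (trans (cong (λ c → opposite c r) (not-not (χ v)))
        (sym (cong (_∸ 2) (trans (count-pick₂ _ i)
            (cong₂ (λ b c → ⟦ b ⟧ + (⟦ c ⟧ + opposite (χ v) r)) vx vy))))))
      (trans (cong (λ c → opposite c r) (xor-cancel (χ v) vy))
        (sym (trans (count-pick₂ _ i)
            (cong₂ (λ b c → ⟦ b ⟧ + (⟦ c ⟧ + opposite (not (χ v)) r)) (xor-not (χ v) vx)
            (xor-not (χ v) vy))))))
    where
    not-not : ∀ c → not (not c) ≡ c
    not-not true = refl
    not-not false = refl

  thruCount-bipartite : ∀ v S → 2 * thruCount v S ≡ Θ (opposite (χ v) S) (opposite (not (χ v)) S)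
  thruCount-bipartite v S = begin
    2 * thruCount v S   ≡⟨ cong (2 *_) (sum₂-cong S (λ {x} {y} {r} i → pair x y r i)) ⟩
    2 * sum₂ S (λ x y r → if across v x ∧ across v y then sameSidePaths (b ∸ 2) a else 0)
        ≡⟨ sum₂-const S (across v) (sameSidePaths (b ∸ 2) a) ⟩
    b * (b ∸ 1) * sameSidePaths (b ∸ 2) a  ≡⟨ Θ≡sameSidePaths b a ⟩
    Θ b a ∎
    where
    open ≡-Reasoning
    a = opposite (not (χ v)) S
    b = opposite (χ v) S
    pair : ∀ x y r → Pick₂ S x y r →
        (if across v x ∧ across v y then pathCount (length r) r x y else 0) ≡
        (if across v x ∧ across v y then sameSidePaths (b ∸ 2) a else 0)
    pair x y r i = if-cong (across v x ∧ across v y) λ vxy →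
        pathCount-pair v i (proj₁ (∧-true vxy)) (proj₂ (∧-true vxy))

  κ-insert : ∀ v S → κ (opposite false (v ∷ S)) (opposite true (v ∷ S)) ≡
              Θ (opposite (χ v) S) (opposite (not (χ v)) S) + κ (opposite false S) (opposite true S)
  κ-insert v S with χ v
  ... | true  = +-comm (κ (opposite false S) (opposite true S)) _
  ... | false = trans (κ-suc (opposite false S) (opposite true S))
      (+-comm (κ (opposite false S) (opposite true S)) _)

  cycleCount-bipartite : ∀ S → 2 * cycleCount S ≡ κ (opposite false S) (opposite true S)
  cycleCount-bipartite [] = refl
  cycleCount-bipartite (v ∷ S) = begin
    2 * (thruCount v S + cycleCount S)        ≡⟨ *-distribˡ-+ 2 (thruCount v S) (cycleCount S) ⟩
    2 * thruCount v S + 2 * cycleCount S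
        ≡⟨ cong₂ _+_ (thruCount-bipartite v S) (cycleCount-bipartite S) ⟩
    Θ (opposite (χ v) S) (opposite (not (χ v)) S) + κ (opposite false S) (opposite true S)  ≡⟨ κ-insert v S ⟨
    κ (opposite false (v ∷ S)) (opposite true (v ∷ S))  ∎
    where open ≡-Reasoning

  -- `P` will be membership in a fixed list: a colouring is known to be proper only there, while the
  -- lists in the recursion shrink.
  module _ (adj : V → V → Bool) {P : V → Set} (sub : ∀ {x y} → P x → P y → adj x y ≡ true → across x y ≡ true)
      where

    private module G = Paths adj

    ⟦⟧-mono : ∀ {b c} → (b ≡ true → c ≡ true) → ⟦ b ⟧ ≤ ⟦ c ⟧
    ⟦⟧-mono {true} h rewrite h refl = ≤-refl
    ⟦⟧-mono {false} h = z≤n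

    if-mono : ∀ {b c m n} → (b ≡ true → c ≡ true) → m ≤ n → (if b then m else 0) ≤ (if c then n else 0)
    if-mono {true} h m≤n rewrite h refl = m≤n
    if-mono {false} h m≤n = z≤n

    pathCount-mono : ∀ k {S x y} → All P S → P x → P y → G.pathCount k S x y ≤ pathCount k S x y
    pathCount-mono zero    S⊆ px py = ⟦⟧-mono (sub px py)
    pathCount-mono (suc k) {S} S⊆ px py = +-mono-≤ (⟦⟧-mono (sub px py)) (sum₁-mono S λ i →
      if-mono (sub px (proj₁ (All-pick i S⊆)))
          (pathCount-mono k (proj₂ (All-pick i S⊆)) (proj₁ (All-pick i S⊆)) py))

    count-sub : ∀ {v S} → P v → All P S → count (adj v) S ≤ count (across v) S
    count-sub pv [] = z≤n
    count-sub pv (px ∷ pS) = +-mono-≤ (⟦⟧-mono (sub pv px)) (count-sub pv pS)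

    -- Paths are compared with those of the complete bipartite graph, but the degree of `v` stays
    -- that of `adj`, so that a missing edge at `v` remains visible.
    thruCount-sub : ∀ {v S} → P v → All P S → 2 * G.thruCount v S ≤
      count (adj v) S * (count (adj v) S ∸ 1) * sameSidePaths (opposite (χ v) S ∸ 2) (opposite (not (χ v)) S)
    thruCount-sub {v} {S} pv S⊆ = G.thruCount-bound v S _ λ {x} {y} {r} i vx vy →
      let (px , py , r⊆) = All-pick₂ i S⊆ in
      ≤-trans (pathCount-mono (length r) r⊆ px py)
          (≤-reflexive (pathCount-pair v i (sub pv px vx) (sub pv py vy)))

    thruCount-sub-≤ : ∀ {v S} → P v → All P S →
        2 * G.thruCount v S ≤ Θ (opposite (χ v) S) (opposite (not (χ v)) S)
    thruCount-sub-≤ {v} {S} pv S⊆ = ≤-trans (thruCount-sub pv S⊆) (≤-trans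
      (*-monoˡ-≤ (sameSidePaths (opposite (χ v) S ∸ 2) (opposite (not (χ v)) S))
          (*-mono-≤ d≤b (∸-monoˡ-≤ 1 d≤b)))
      (≤-reflexive (Θ≡sameSidePaths (opposite (χ v) S) (opposite (not (χ v)) S))))
      where d≤b = count-sub pv S⊆

    -- The lower bounds on the two parts make `b − 1` and the number of paths positive; otherwise
    -- `v` would lie on no cycle even of the complete bipartite graph.
    thruCount-sub-< : ∀ {v S} → P v → All P S → count (adj v) S < opposite (χ v) S →
      2 ≤ opposite (χ v) S → 1 ≤ opposite (not (χ v)) S →
      2 * G.thruCount v S < Θ (opposite (χ v) S) (opposite (not (χ v)) S)
    thruCount-sub-< {v} {S} pv S⊆ d<b 2≤b 1≤a = ≤-<-trans (thruCount-sub pv S⊆) (<-≤-trans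
      (*-monoˡ-< (sameSidePaths (b ∸ 2) a) {{>-nonZero (sameSidePaths-pos (b ∸ 2) 1≤a)}}
          (≤-<-trans (*-monoʳ-≤ d (∸-monoˡ-≤ 1 (<⇒≤ d<b)))
        (*-monoˡ-< (b ∸ 1) {{>-nonZero (∸-monoˡ-≤ 1 2≤b)}} d<b)))
      (≤-reflexive (Θ≡sameSidePaths b a)))
      where
      a = opposite (not (χ v)) S
      b = opposite (χ v) S
      d = count (adj v) S
      sameSidePaths-pos : ∀ p {q} → 1 ≤ q → 0 < sameSidePaths p q
      sameSidePaths-pos p {suc q} _ = *-mono-≤ (s≤s (z≤n {q})) (crossPaths-pos p q)

    cycleCount-sub : ∀ {S} → All P S → 2 * G.cycleCount S ≤ κ (opposite false S) (opposite true S)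
    cycleCount-sub [] = z≤n
    cycleCount-sub {v ∷ S} (pv ∷ pS) =
        ≤-trans (≤-reflexive (*-distribˡ-+ 2 (G.thruCount v S) (G.cycleCount S)))
      (≤-trans (+-mono-≤ (thruCount-sub-≤ pv pS) (cycleCount-sub pS)) (≤-reflexive (sym (κ-insert v S))))

    cycleCount-sub-< : ∀ {v S} → P v → All P S → count (adj v) S < opposite (χ v) S →
      2 ≤ opposite (χ v) S → 1 ≤ opposite (not (χ v)) S →
      2 * G.cycleCount (v ∷ S) < κ (opposite false (v ∷ S)) (opposite true (v ∷ S))
    cycleCount-sub-< {v} {S} pv pS d<b 2≤b 1≤a =
        ≤-<-trans (≤-reflexive (*-distribˡ-+ 2 (G.thruCount v S) (G.cycleCount S)))
      (<-≤-trans (+-mono-<-≤ (thruCount-sub-< pv pS d<b 2≤b 1≤a) (cycleCount-sub pS))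
          (≤-reflexive (sym (κ-insert v S))))

-- The upper bound and its strict cases

Pick-other : ∀ {A : Set} {S : List A} {u r y} → Pick S u r → y ∈ S → y ≡ u ⊎ y ∈ r
Pick-other here (here refl) = inj₁ refl
Pick-other here (there y∈) = inj₂ y∈
Pick-other (there i) (here refl) = inj₂ (here refl)
Pick-other (there i) (there y∈) with Pick-other i y∈
... | inj₁ y≡u = inj₁ y≡u
... | inj₂ y∈r = inj₂ (there y∈r)

other-half : ∀ m n → n ≡ ⌊ m + n /2⌋ → m ≡ ⌈ m + n /2⌉
other-half m n e = +-cancelˡ-≡ n _ _
    (trans (+-comm n m) (trans (sym (⌊n/2⌋+⌈n/2⌉≡n (m + n))) (cong (_+ ⌈ m + n /2⌉) (sym e))))

halves-large : ∀ m n → 6 ≤ m + n → n ≡ ⌊ m + n /2⌋ ⊎ m ≡ ⌊ m + n /2⌋ → 3 ≤ m × 3 ≤ n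
halves-large m n 6≤ (inj₁ e) =
    ≤-trans (⌈n/2⌉-mono 6≤) (≤-reflexive (sym (other-half m n e))) , ≤-trans (⌊n/2⌋-mono 6≤)
    (≤-reflexive (sym e))
halves-large m n 6≤ (inj₂ e) with halves-large n m (≤-trans 6≤ (≤-reflexive (+-comm m n)))
    (inj₁ (trans e (cong ⌊_/2⌋ (+-comm m n))))
... | 3≤n , 3≤m = 3≤m , 3≤n

module Extremal {V : Set} (adj : V → V → Bool)
  (symm : ∀ x y → adj x y ≡ true → adj y x ≡ true)
  (tri  : ∀ x y z → adj x y ≡ true → adj y z ≡ true → adj x z ≡ false) where

  open Paths adj
  open TriangleFreePaths adj symm tri
  open Dichotomy adj symm tri

  thruCount-≤ : ∀ v S → 2 * thruCount v S ≤ count (adj v) S * (count (adj v) S ∸ 1) * pathBound (length S ∸ 2)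
  thruCount-≤ v S = thruCount-bound v S _ λ {x} {y} {r} i _ _ →
    ≤-trans (pathCount-bound (length r) x y r refl)
        (≤-reflexive (cong (λ n → pathBound (n ∸ 2)) (sym (length-pick₂ i))))

  low-degree : ∀ v S → 5 * count (adj v) S ≤ 2 * (1 + length S) → 2 * cycleCount S ≤ κ-bal (length S) →
               2 * cycleCount (v ∷ S) ≤ κ-bal (length (v ∷ S))
  low-degree v S low ih = begin
    2 * (thruCount v S + cycleCount S)            ≡⟨ *-distribˡ-+ 2 (thruCount v S) (cycleCount S) ⟩
    2 * thruCount v S + 2 * cycleCount S
        ≤⟨ +-mono-≤ (≤-trans (thruCount-≤ v S) (gain-bound (count (adj v) S) (length S) low)) ih ⟩
    gain (length S) + κ-bal (length S)  ≡⟨ +-comm (gain (length S)) _ ⟩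
    κ-bal (length (v ∷ S))           ∎
    where open ≤-Reasoning

  low-degree-< : ∀ v S → 5 ≤ length S → 5 * count (adj v) S ≤ 2 * (1 + length S) →
      2 * cycleCount S ≤ κ-bal (length S) →
               2 * cycleCount (v ∷ S) < κ-bal (length (v ∷ S))
  low-degree-< v S 5≤n low ih = begin-strict
    2 * (thruCount v S + cycleCount S)            ≡⟨ *-distribˡ-+ 2 (thruCount v S) (cycleCount S) ⟩
    2 * thruCount v S + 2 * cycleCount S
        <⟨ +-mono-<-≤ (≤-<-trans (thruCount-≤ v S) (gain-bound-< (count (adj v) S) (length S) 5≤n low)) ih ⟩
    gain (length S) + κ-bal (length S)  ≡⟨ +-comm (gain (length S)) _ ⟩
    κ-bal (length (v ∷ S))           ∎
    where open ≤-Reasoning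

  proper-cyc : ∀ {χ L} → Proper χ L → 2 * cycleCount L ≤ κ (count χ L) (count (not ∘ χ) L)
  proper-cyc {χ} {L} proper = Bipartite.cycleCount-sub χ adj {_∈ L} proper (All.tabulate (λ i → i))

  proper-bal : ∀ {χ L} → Proper χ L → 2 * cycleCount L ≤ κ-bal (length L)
  proper-bal {χ} {L} proper = ≤-trans (proper-cyc {χ} proper)
    (≤-trans (κ-max (count χ L) _) (≤-reflexive (cong κ-bal (count-not χ L))))

  low-degree-pick : ∀ {v L r S} → Pick L v r → S ↭ r → 5 * count (adj v) L ≤ 2 * length L →
                    5 * count (adj v) S ≤ 2 * (1 + length S)
  low-degree-pick {v} {L} {r} {S} i S↭r low = begin
    5 * count (adj v) S   ≡⟨ cong (5 *_) (count-↭ (adj v) S↭r) ⟩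
    5 * count (adj v) r
        ≤⟨ *-monoʳ-≤ 5 (≤-trans (m≤n+m _ ⟦ adj v v ⟧) (≤-reflexive (sym (count-pick (adj v) i)))) ⟩
    5 * count (adj v) L   ≤⟨ low ⟩
    2 * length L          ≡⟨ cong (2 *_) (trans (length-pick i) (cong suc (sym (↭-length S↭r)))) ⟩
    2 * (1 + length S)    ∎
    where open ≤-Reasoning

  -- The dichotomy is applied afresh to what is left after each deletion, and a bipartite remainder
  -- ends the induction. `L′` records the order of deletion that results.
  cycles-≤ : ∀ n L → length L ≡ n → ∃ λ L′ → L′ ↭ L × 2 * cycleCount L′ ≤ κ-bal (length L′)
  cycles-≤ zero [] _ = [] , ↭-refl , z≤n
  cycles-≤ (suc n) L len with dichotomy L
  ... | inj₂ (χ , proper) = L , ↭-refl , proper-bal {χ} proper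
  ... | inj₁ (v , v∈ , low) with Pick-∈ v∈
  ...   | r , i with cycles-≤ n r (suc-injective (trans (sym (length-pick i)) len))
  ...     | S , S↭r , ih = v ∷ S , ↭-trans (prep v S↭r) (↭-sym (Pick⇒↭ i)) ,
                           low-degree v S (low-degree-pick i S↭r low) ih

  -- Only the first deletion has to be strict. It leaves at least five vertices, as `gain-bound-<`
  -- requires.
  non-bipartite-< : ∀ L → 6 ≤ length L → (∃ λ v → v ∈ L × 5 * count (adj v) L ≤ 2 * length L) →
                    ∃ λ L′ → L′ ↭ L × 2 * cycleCount L′ < κ-bal (length L′)
  non-bipartite-< L 6≤n (v , v∈ , low) with Pick-∈ v∈
  ... | r , i with cycles-≤ (length r) r refl
  ...   | S , S↭r , ih = v ∷ S , ↭-trans (prep v S↭r) (↭-sym (Pick⇒↭ i)) ,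
    low-degree-< v S (s≤s⁻¹
        (≤-trans 6≤n (≤-reflexive (trans (length-pick i) (cong suc (sym (↭-length S↭r)))))))
        (low-degree-pick i S↭r low) ih

  -- An end `x` of the missing edge is put first. Either the part sizes are not optimal, and `κ m n`
  -- is already too small, or they are balanced; then both parts have at least three vertices and
  -- the lost edge costs cycles through `x`.
  missing-edge-< : ∀ {χ} L {x y} → 6 ≤ length L → Proper χ L → x ∈ L → y ∈ L → χ x xor χ y ≡ true →
      adj x y ≡ false →
                   ∃ λ L′ → L′ ↭ L × 2 * cycleCount L′ < κ-bal (length L′)
  missing-edge-< {χ} L {x} {y} 6≤n proper x∈ y∈ xy miss with Pick-∈ x∈
  ... | r , i = x ∷ r , ↭-sym (Pick⇒↭ i) , strict
    where
    open Bipartite χ using (opposite; across; cycleCount-sub-<; cycleCount-sub; count-sub; xor-same; xor-opp)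
    S = x ∷ r
    L⊆ : All (_∈ L) L
    L⊆ = All.tabulate (λ i → i)
    r⊆ : All (_∈ L) r
    r⊆ = proj₂ (All-pick i L⊆)
    m = opposite false S
    n = opposite true S
    m+n : m + n ≡ length S
    m+n = count-not χ S
    6≤ : 6 ≤ m + n
    6≤ = ≤-trans 6≤n (≤-reflexive (trans (length-pick i) (sym m+n)))
    y∈r : y ∈ r
    y∈r with Pick-other i y∈
    ... | inj₂ y∈r = y∈r
    ... | inj₁ refl = contradiction (trans (sym xy) (xor-same (χ x))) λ ()
    fewer : count (adj x) r < opposite (χ x) r
    fewer with Pick-∈ y∈r
    ... | r′ , j = begin-strict
      count (adj x) r                       ≡⟨ count-pick (adj x) j ⟩
      ⟦ adj x y ⟧ + count (adj x) r′        ≡⟨ cong (λ b → ⟦ b ⟧ + count (adj x) r′) miss ⟩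
      count (adj x) r′                      ≤⟨ count-sub adj {_∈ L} proper x∈ (proj₂ (All-pick j r⊆)) ⟩
      opposite (χ x) r′                     <⟨ n<1+n _ ⟩
      1 + opposite (χ x) r′                 ≡⟨ cong (λ b → ⟦ b ⟧ + opposite (χ x) r′) xy ⟨
      ⟦ χ x xor χ y ⟧ + opposite (χ x) r′   ≡⟨ count-pick (λ z → χ x xor χ z) j ⟨
      opposite (χ x) r                      ∎
      where open ≤-Reasoning
    strict : 2 * cycleCount S < κ-bal (length S)
    strict with κ-bal (m + n) ≤? κ m n
    ... | no ≰ = ≤-<-trans (cycleCount-sub adj {_∈ L} proper (x∈ ∷ r⊆))
        (<-≤-trans (≰⇒> ≰) (≤-reflexive (cong κ-bal m+n)))
    ... | yes max = <-≤-trans (cycleCount-sub-< adj {_∈ L} proper x∈ r⊆ fewer 2≤b 1≤a)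
                      (≤-trans (κ-max m n) (≤-reflexive (cong κ-bal m+n)))
      where
      large : 3 ≤ m × 3 ≤ n
      large = halves-large m n 6≤ (κ-max-unique m n (≤-trans (m≤n+m 4 2) 6≤) max)
      parts : ∀ c → 3 ≤ opposite c S
      parts true  = proj₂ large
      parts false = proj₁ large
      2≤b : 2 ≤ opposite (χ x) r
      2≤b = ≤-trans (n≤1+n 2)
          (≤-trans (parts (χ x)) (≤-reflexive (cong (λ b → ⟦ b ⟧ + opposite (χ x) r) (xor-same (χ x)))))
      1≤a : 1 ≤ opposite (not (χ x)) r
      1≤a = ≤-trans (n≤1+n 1)
          (s≤s⁻¹ (≤-trans (parts (not (χ x)))
          (≤-reflexive (cong (λ b → ⟦ b ⟧ + opposite (not (χ x)) r) (xor-opp (χ x))))))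

-- Enumerating the cycles

Pick⇒∈ : ∀ {A : Set} {S : List A} {u r} → Pick S u r → u ∈ S
Pick⇒∈ here = here refl
Pick⇒∈ (there i) = there (Pick⇒∈ i)

Pick-⊆ : ∀ {A : Set} {S : List A} {u r z} → Pick S u r → z ∈ r → z ∈ S
Pick-⊆ here z∈ = there z∈
Pick-⊆ (there i) (here refl) = here refl
Pick-⊆ (there i) (there z∈) = there (Pick-⊆ i z∈)

Pick₂⇒∈ : ∀ {A : Set} {S : List A} {a b r} → Pick₂ S a b r → a ∈ S × b ∈ S
Pick₂⇒∈ (here i) = here refl , there (Pick⇒∈ i)
Pick₂⇒∈ (there i) = there (proj₁ (Pick₂⇒∈ i)) , there (proj₂ (Pick₂⇒∈ i))

Pick₂-⊆ : ∀ {A : Set} {S : List A} {a b r z} → Pick₂ S a b r → z ∈ r → z ∈ S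
Pick₂-⊆ (here i) z∈ = there (Pick-⊆ i z∈)
Pick₂-⊆ (there i) (here refl) = here refl
Pick₂-⊆ (there i) (there z∈) = there (Pick₂-⊆ i z∈)

Unique-head : ∀ {A : Set} {x : A} {xs} → Unique (x ∷ xs) → x ∉ xs
Unique-head (x∉ ∷ _) x∈ = All.lookup x∉ x∈ refl

Unique-tail : ∀ {A : Set} {x : A} {xs} → Unique (x ∷ xs) → Unique xs
Unique-tail (_ ∷ u) = u

∉⇒Unique : ∀ {A : Set} {x : A} {xs} → x ∉ xs → Unique xs → Unique (x ∷ xs)
∉⇒Unique x∉ u = All.tabulate (λ { y∈ refl → x∉ y∈ }) ∷ u

Unique-pick : ∀ {A : Set} {S : List A} {u r} → Unique S → Pick S u r → Unique r × u ∉ r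
Unique-pick u here = Unique-tail u , Unique-head u
Unique-pick u (there i) with Unique-pick (Unique-tail u) i
... | ur , u∉ = ∉⇒Unique (Unique-head u ∘ Pick-⊆ i) ur ,
                λ { (here refl) → Unique-head u (Pick⇒∈ i) ; (there u∈) → u∉ u∈ }

Unique-pick₂ : ∀ {A : Set} {S : List A} {a b r} → Unique S → Pick₂ S a b r → Unique r × a ∉ r × b ∉ r × a ≢ b
Unique-pick₂ u (here i) with Unique-pick (Unique-tail u) i
... | ur , b∉ = ur , Unique-head u ∘ Pick-⊆ i , b∉ , λ { refl → Unique-head u (Pick⇒∈ i) }
Unique-pick₂ u (there i) with Unique-pick₂ (Unique-tail u) i | Pick₂⇒∈ i
... | ur , a∉ , b∉ , a≢b | a∈ , b∈ = ∉⇒Unique (Unique-head u ∘ Pick₂-⊆ i) ur ,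
  (λ { (here refl) → Unique-head u a∈ ; (there z∈) → a∉ z∈ }) ,
  (λ { (here refl) → Unique-head u b∈ ; (there z∈) → b∉ z∈ }) , a≢b

Pick₂-asym : ∀ {A : Set} {S : List A} {a b r r′} → Unique S → Pick₂ S a b r → ¬ Pick₂ S b a r′
Pick₂-asym u (here i) (here j) = Unique-head u (Pick⇒∈ j)
Pick₂-asym u (here i) (there j) = Unique-head u (proj₂ (Pick₂⇒∈ j))
Pick₂-asym u (there i) (here j) = Unique-head u (proj₂ (Pick₂⇒∈ i))
Pick₂-asym u (there i) (there j) = Pick₂-asym (Unique-tail u) i j

Pick₂-∈ : ∀ {A : Set} {S : List A} {a b} → a ∈ S → b ∈ S → a ≢ b → ∃ (Pick₂ S a b) ⊎ ∃ (Pick₂ S b a)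
Pick₂-∈ (here refl) (here refl) a≢b = contradiction refl a≢b
Pick₂-∈ (here refl) (there b∈) _ = inj₁ (_ , here (proj₂ (Pick-∈ b∈)))
Pick₂-∈ (there a∈) (here refl) _ = inj₂ (_ , here (proj₂ (Pick-∈ a∈)))
Pick₂-∈ (there a∈) (there b∈) a≢b with Pick₂-∈ a∈ b∈ a≢b
... | inj₁ (_ , i) = inj₁ (_ , there i)
... | inj₂ (_ , i) = inj₂ (_ , there i)

Pick₂-other : ∀ {A : Set} {S : List A} {a b r z} → Pick₂ S a b r → z ∈ S → z ≢ a → z ≢ b → z ∈ r
Pick₂-other (here i) (here refl) z≢a _ = contradiction refl z≢a
Pick₂-other (here i) (there z∈) _ z≢b with Pick-other i z∈
... | inj₁ z≡b = contradiction z≡b z≢b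
... | inj₂ z∈r = z∈r
Pick₂-other (there i) (here refl) _ _ = here refl
Pick₂-other (there i) (there z∈) z≢a z≢b = there (Pick₂-other i z∈ z≢a z≢b)

length-⊆ : ∀ {A : Set} {xs ys : List A} → Unique xs → (∀ {z} → z ∈ xs → z ∈ ys) → length xs ≤ length ys
length-⊆ {xs = []} _ _ = z≤n
length-⊆ {xs = x ∷ xs} u ⊆ys with Pick-∈ (⊆ys (here refl))
... | r , i = ≤-trans (s≤s (length-⊆ (Unique-tail u) ⊆r)) (≤-reflexive (sym (length-pick i)))
  where
  ⊆r : ∀ {z} → z ∈ xs → z ∈ r
  ⊆r z∈ with Pick-other i (⊆ys (there z∈))
  ... | inj₁ refl = contradiction z∈ (Unique-head u)
  ... | inj₂ z∈r = z∈r

-- Injectivity is asked on the members only: `edgeSet` identifies the rotations and reversals of a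
-- cycle, of which the enumeration contains one.
Unique-map : ∀ {A B : Set} (f : A → B) {xs} → Unique xs → (∀ {a b} → a ∈ xs → b ∈ xs → f a ≡ f b → a ≡ b) →
    Unique (map f xs)
Unique-map f {[]} _ _ = []
Unique-map f {x ∷ xs} u inj =
    ∉⇒Unique fx∉ (Unique-map f (Unique-tail u) (λ a∈ b∈ → inj (there a∈) (there b∈)))
  where
  fx∉ : f x ∉ map f xs
  fx∉ fx∈ with ∈-map⁻ f fx∈
  ... | y , y∈ , eq with inj (here refl) (there y∈) eq
  ...   | refl = Unique-head u y∈

module _ {A B : Set} where

  concat₁ : List A → (A → List A → List B) → List B
  concat₁ []       f = []
  concat₁ (x ∷ xs) f = f x xs ++ concat₁ xs (λ u r → f u (x ∷ r))

  concat₂ : List A → (A → A → List A → List B) → List B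
  concat₂ []       f = []
  concat₂ (x ∷ xs) f = concat₁ xs (f x) ++ concat₂ xs (λ a b r → f a b (x ∷ r))

  length-concat₁ : ∀ S f → length (concat₁ S f) ≡ sum₁ S (λ u r → length (f u r))
  length-concat₁ [] f = refl
  length-concat₁ (x ∷ S) f = trans (length-++ (f x S)) (cong (length (f x S) +_) (length-concat₁ S _))

  length-concat₂ : ∀ S f → length (concat₂ S f) ≡ sum₂ S (λ a b r → length (f a b r))
  length-concat₂ [] f = refl
  length-concat₂ (x ∷ S) f =
      trans (length-++ (concat₁ S (f x))) (cong₂ _+_ (length-concat₁ S (f x)) (length-concat₂ S _))

  ∈-concat₁⁺ : ∀ {S u r c} f → Pick S u r → c ∈ f u r → c ∈ concat₁ S f
  ∈-concat₁⁺ f here c∈ = ∈-++⁺ˡ c∈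
  ∈-concat₁⁺ {x ∷ S} f (there i) c∈ = ∈-++⁺ʳ (f x S) (∈-concat₁⁺ _ i c∈)

  ∈-concat₁⁻ : ∀ S {c} f → c ∈ concat₁ S f → ∃₂ λ u r → Pick S u r × c ∈ f u r
  ∈-concat₁⁻ (x ∷ S) f c∈ with ∈-++⁻ (f x S) c∈
  ... | inj₁ c∈fx = x , S , here , c∈fx
  ... | inj₂ c∈₁ = let (u , r , i , c∈fur) = ∈-concat₁⁻ S _ c∈₁ in u , x ∷ r , there i , c∈fur

  ∈-concat₂⁺ : ∀ {S a b r c} f → Pick₂ S a b r → c ∈ f a b r → c ∈ concat₂ S f
  ∈-concat₂⁺ f (here i) c∈ = ∈-++⁺ˡ (∈-concat₁⁺ _ i c∈)
  ∈-concat₂⁺ {x ∷ S} f (there i) c∈ = ∈-++⁺ʳ (concat₁ S (f x)) (∈-concat₂⁺ _ i c∈)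

  ∈-concat₂⁻ : ∀ S {c} f → c ∈ concat₂ S f → ∃ λ a → ∃₂ λ b r → Pick₂ S a b r × c ∈ f a b r
  ∈-concat₂⁻ (x ∷ S) f c∈ with ∈-++⁻ (concat₁ S (f x)) c∈
  ... | inj₁ c∈₁ = let (b , r , i , c∈fbr) = ∈-concat₁⁻ S (f x) c∈₁ in x , b , r , here i , c∈fbr
  ... | inj₂ c∈₂ = let (a , b , r , i , c∈fabr) = ∈-concat₂⁻ S _ c∈₂ in a , b , x ∷ r , there i , c∈fabr

  -- `Key` reads off from an element the vertex whose block it came from, so distinct blocks are
  -- disjoint.
  Unique-concat₁ : ∀ {S} f (Key : B → A → Set) → (∀ {c u v} → Key c u → Key c v → u ≡ v) →
    (∀ {u r c} → Pick S u r → c ∈ f u r → Key c u) → Unique S → (∀ {u r} → Pick S u r → Unique (f u r)) →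
        Unique (concat₁ S f)
  Unique-concat₁ {[]} f Key fun key u uf = []
  Unique-concat₁ {x ∷ S} f Key fun key u uf = Unique.++⁺ (uf here)
    (Unique-concat₁ _ Key fun (key ∘ there) (Unique-tail u) (uf ∘ there)) disjoint
    where
    disjoint : ∀ {c} → ¬ (c ∈ f x S × c ∈ concat₁ S _)
    disjoint (c∈ , c∈′) with ∈-concat₁⁻ S _ c∈′
    ... | v , r , i , c∈″ with fun (key here c∈) (key (there i) c∈″)
    ...   | refl = Unique-head u (Pick⇒∈ i)

  Unique-concat₂ : ∀ {S} f (Key : B → A → A → Set) →
      (∀ {c a b a′ b′} → Key c a b → Key c a′ b′ → a ≡ a′ × b ≡ b′) →
    (∀ {a b r c} → Pick₂ S a b r → c ∈ f a b r → Key c a b) → Unique S →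
        (∀ {a b r} → Pick₂ S a b r → Unique (f a b r)) → Unique (concat₂ S f)
  Unique-concat₂ {[]} f Key fun key u uf = []
  Unique-concat₂ {x ∷ S} f Key fun key u uf = Unique.++⁺
    (Unique-concat₁ (f x) (λ c b → Key c x b) (λ k k′ → proj₂ (fun k k′)) (key ∘ here) (Unique-tail u)
        (uf ∘ here))
    (Unique-concat₂ _ Key fun (key ∘ there) (Unique-tail u) (uf ∘ there)) disjoint
    where
    disjoint : ∀ {c} → ¬ (c ∈ concat₁ S (f x) × c ∈ concat₂ S _)
    disjoint (c∈ , c∈′) with ∈-concat₁⁻ S (f x) c∈ | ∈-concat₂⁻ S _ c∈′
    ... | b , r , i , c∈₁ | a′ , b′ , r′ , j , c∈₂ with proj₁ (fun (key (here i) c∈₁) (key (there j) c∈₂))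
    ...   | refl = Unique-head u (proj₁ (Pick₂⇒∈ j))

module Enumeration {V : Set} (adj : V → V → Bool) where

  open Paths adj

  -- Paths are listed without their first vertex.
  edge : V → V → List (List V)
  edge x y = if adj x y then (y ∷ []) ∷ [] else []

  paths : ℕ → List V → V → V → List (List V)
  paths zero    S x y = edge x y
  paths (suc k) S x y = edge x y ++
                        concat₁ S (λ u r → if adj x u then map (u ∷_) (paths k r u y) else [])

  extend : V → V → List V → List V
  extend v x q = v ∷ x ∷ q

  cyclesThru : V → List V → List (List V)
  cyclesThru v S = concat₂ S
      (λ x y r → if adj v x ∧ adj v y then map (extend v x) (paths (length r) r x y) else [])

  cycles : List V → List (List V)
  cycles []      = []
  cycles (v ∷ S) = cyclesThru v S ++ cycles S

  length-if : ∀ {A B : Set} b {f : A → B} {xs n} → length xs ≡ n →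
      length (if b then map f xs else []) ≡ (if b then n else 0)
  length-if true {f} {xs} e = trans (length-map f xs) e
  length-if false e = refl

  length-paths : ∀ k S x y → length (paths k S x y) ≡ pathCount k S x y
  length-paths zero S x y with adj x y
  ... | true = refl
  ... | false = refl
  length-paths (suc k) S x y = trans (length-++ (edge x y)) (cong₂ _+_ (length-paths zero S x y)
    (trans (length-concat₁ S _) (sum₁-cong S λ {u} {r} _ → length-if (adj x u) (length-paths k r u y))))

  length-cycles : ∀ L → length (cycles L) ≡ cycleCount L
  length-cycles [] = refl
  length-cycles (v ∷ S) = trans (length-++ (cyclesThru v S)) (cong₂ _+_ (trans (length-concat₂ S _)
    (sum₂-cong S λ {x} {y} {r} _ → length-if (adj v x ∧ adj v y) (length-paths (length r) r x y)))
        (length-cycles S))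

  data Path (y : V) : List V → V → List V → Set where
    stop : ∀ {S x} → adj x y ≡ true → Path y S x (y ∷ [])
    step : ∀ {S x u r q} → Pick S u r → adj x u ≡ true → Path y r u q → Path y S x (u ∷ q)

  -- Of the `2m` ways to write a cycle of length `m` as a list, one is selected: it starts at the
  -- vertex that comes first in the given list and sets out towards the earlier of the two
  -- neighbours of that vertex.
  data Cycle : List V → List V → Set where
    here  : ∀ {v S x y r q} → Pick₂ S x y r → adj v x ≡ true → adj v y ≡ true → Path y r x q →
        Cycle (v ∷ S) (v ∷ x ∷ q)
    there : ∀ {v S c} → Cycle S c → Cycle (v ∷ S) c

  ∈-if : ∀ {A : Set} {b} {xs : List A} {z} → z ∈ (if b then xs else []) → b ≡ true × z ∈ xs
  ∈-if {b = true} z∈ = refl , z∈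

  if-∈ : ∀ {A : Set} {b} {xs : List A} {z} → b ≡ true → z ∈ xs → z ∈ (if b then xs else [])
  if-∈ refl z∈ = z∈

  ∈-paths⁻ : ∀ k S x y {q} → q ∈ paths k S x y → Path y S x q
  ∈-paths⁻ zero S x y q∈ with ∈-if {b = adj x y} q∈
  ... | xy , here refl = stop xy
  ∈-paths⁻ (suc k) S x y q∈ with ∈-++⁻ (edge x y) q∈
  ... | inj₁ q∈₀ = ∈-paths⁻ zero S x y q∈₀
  ... | inj₂ q∈₁ with ∈-concat₁⁻ S _ q∈₁
  ...   | u , r , i , q∈₂ with ∈-if {b = adj x u} q∈₂
  ...     | xu , q∈₃ with ∈-map⁻ (u ∷_) q∈₃
  ...       | q , q∈₄ , refl = step i xu (∈-paths⁻ k r u y q∈₄)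

  ∈-paths⁺ : ∀ k {S x y q} → length S ≡ k → Path y S x q → q ∈ paths k S x y
  ∈-paths⁺ zero len (stop xy) = if-∈ xy (here refl)
  ∈-paths⁺ (suc k) len (stop xy) = ∈-++⁺ˡ (if-∈ xy (here refl))
  ∈-paths⁺ zero {[]} len (step () xu p)
  ∈-paths⁺ (suc k) {S} {x} {y} len (step {u = u} i xu p) = ∈-++⁺ʳ (edge x y)
    (∈-concat₁⁺ _ i (if-∈ xu
        (∈-map⁺ (u ∷_) (∈-paths⁺ k (suc-injective (trans (sym (length-pick i)) len)) p))))

  ∧-intro : ∀ {a b} → a ≡ true → b ≡ true → a ∧ b ≡ true
  ∧-intro refl refl = refl

  ∈-cycles⁺ : ∀ {L c} → Cycle L c → c ∈ cycles L
  ∈-cycles⁺ (here {v} {x = x} i vx vy p) =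
      ∈-++⁺ˡ (∈-concat₂⁺ _ i (if-∈ (∧-intro vx vy) (∈-map⁺ (extend v x) (∈-paths⁺ _ refl p))))
  ∈-cycles⁺ (there {v} {S} c) = ∈-++⁺ʳ (cyclesThru v S) (∈-cycles⁺ c)

  ∈-thru⁻ : ∀ v S {c} → c ∈ cyclesThru v S →
            ∃ λ x → ∃₂ λ y r → ∃ λ q → c ≡ v ∷ x ∷ q × Pick₂ S x y r × adj v x ≡ true × adj v y ≡ true ×
                Path y r x q
  ∈-thru⁻ v S c∈ with ∈-concat₂⁻ S _ c∈
  ... | x , y , r , i , c∈₁ with ∈-if {b = adj v x ∧ adj v y} c∈₁
  ...   | vxy , c∈₂ with ∈-map⁻ (extend v x) c∈₂
  ...     | q , q∈ , refl =
      x , y , r , q , refl , i , proj₁ (∧-true vxy) , proj₂ (∧-true {adj v x} vxy) , ∈-paths⁻ (length r) r x y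
      q∈

  ∈-cycles⁻ : ∀ L {c} → c ∈ cycles L → Cycle L c
  ∈-cycles⁻ (v ∷ S) c∈ with ∈-++⁻ (cyclesThru v S) c∈
  ... | inj₂ c∈₂ = there (∈-cycles⁻ S c∈₂)
  ... | inj₁ c∈₁ with ∈-thru⁻ v S c∈₁
  ...   | x , y , r , q , refl , i , vx , vy , p = here i vx vy p

  Path-last : ∀ {y S x q} → Path y S x q → ∃ λ p → q ≡ p ∷ʳ y
  Path-last (stop _) = [] , refl
  Path-last (step {u = u} _ _ p) with Path-last p
  ... | q , refl = u ∷ q , refl

  Path-⊆ : ∀ {y S x q z} → Path y S x q → z ∈ q → z ≡ y ⊎ z ∈ S
  Path-⊆ (stop _) (here refl) = inj₁ refl
  Path-⊆ (step i _ _) (here refl) = inj₂ (Pick⇒∈ i)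
  Path-⊆ (step i _ p) (there z∈) with Path-⊆ p z∈
  ... | inj₁ z≡y = inj₁ z≡y
  ... | inj₂ z∈r = inj₂ (Pick-⊆ i z∈r)

  Path-Unique : ∀ {y S x q} → Unique S → y ∉ S → Path y S x q → Unique q
  Path-Unique u y∉ (stop _) = [] ∷ []
  Path-Unique u y∉ (step i _ p) with Unique-pick u i
  ... | ur , u∉r = ∉⇒Unique (λ u∈q → [ (λ { refl → y∉ (Pick⇒∈ i) }) , u∉r ]′ (Path-⊆ p u∈q))
                            (Path-Unique ur (y∉ ∘ Pick-⊆ i) p)

  Cycle-⊆ : ∀ {L c z} → Cycle L c → z ∈ c → z ∈ L
  Cycle-⊆ (here i _ _ p) (here refl) = here refl
  Cycle-⊆ (here i _ _ p) (there (here refl)) = there (proj₁ (Pick₂⇒∈ i))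
  Cycle-⊆ (here i _ _ p) (there (there z∈)) with Path-⊆ p z∈
  ... | inj₁ refl = there (proj₂ (Pick₂⇒∈ i))
  ... | inj₂ z∈r = there (Pick₂-⊆ i z∈r)
  Cycle-⊆ (there c) z∈ = there (Cycle-⊆ c z∈)

  Cycle-Unique : ∀ {L c} → Unique L → Cycle L c → Unique c
  Cycle-Unique u (there c) = Cycle-Unique (Unique-tail u) c
  Cycle-Unique {v ∷ S} u (here {x = x} {y} {r} {q} i vx vy p) with Unique-pick₂ (Unique-tail u) i
  ... | ur , x∉ , y∉ , x≢y = ∉⇒Unique v∉ (∉⇒Unique x∉q (Path-Unique ur y∉ p))
    where
    v∉ : v ∉ x ∷ q
    v∉ v∈ = Unique-head u (⊆S v∈)
      where
      ⊆S : ∀ {z} → z ∈ x ∷ q → z ∈ S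
      ⊆S (here refl) = proj₁ (Pick₂⇒∈ i)
      ⊆S (there z∈) with Path-⊆ p z∈
      ... | inj₁ refl = proj₂ (Pick₂⇒∈ i)
      ... | inj₂ z∈r = Pick₂-⊆ i z∈r
    x∉q : x ∉ q
    x∉q x∈ with Path-⊆ p x∈
    ... | inj₁ x≡y = x≢y x≡y
    ... | inj₂ x∈r = x∉ x∈r

  Unique-if : ∀ {A B : Set} b (f : A → B) {xs} → (∀ {x y} → f x ≡ f y → x ≡ y) → Unique xs →
      Unique (if b then map f xs else [])
  Unique-if true f inj u = Unique.map⁺ inj u
  Unique-if false f inj u = []

  Unique-edge : ∀ x y → Unique (edge x y)
  Unique-edge x y with adj x y
  ... | true  = [] ∷ []
  ... | false = []

  Unique-paths : ∀ k S x y → Unique S → y ∉ S → Unique (paths k S x y)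
  Unique-paths zero S x y u y∉ = Unique-edge x y
  Unique-paths (suc k) S x y u y∉ = Unique.++⁺ (Unique-edge x y)
    (Unique-concat₁ _ (λ c u → ∃ λ q → c ≡ u ∷ q) (λ { (_ , refl) (_ , refl) → refl })
       (λ {u} i c∈ → key u c∈) u
       (λ {z} {r} i → Unique-if (adj x z) (z ∷_) (λ { refl → refl })
           (Unique-paths k r z y (proj₁ (Unique-pick u i)) (y∉ ∘ Pick-⊆ i))))
    disjoint
    where
    key : ∀ u {r c} → c ∈ (if adj x u then map (u ∷_) (paths k r u y) else []) → ∃ λ q → c ≡ u ∷ q
    key u c∈ with ∈-map⁻ (u ∷_) (proj₂ (∈-if {b = adj x u} c∈))
    ... | q , _ , eq = q , eq
    disjoint : ∀ {c} → ¬ (c ∈ edge x y × c ∈ concat₁ S _)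
    disjoint (c∈ , c∈′) with ∈-if {b = adj x y} c∈ | ∈-concat₁⁻ S _ c∈′
    ... | _ , here refl | z , r , i , c∈″ with key z c∈″
    ...   | _ , refl = y∉ (Pick⇒∈ i)

  Unique-cycles : ∀ L → Unique L → Unique (cycles L)
  Unique-cycles [] u = []
  Unique-cycles (v ∷ S) u = Unique.++⁺
    -- The key of a cycle is its second and its last vertex, the two neighbours of `v` on it.
    (Unique-concat₂ _ (λ c x y → ∃ λ p → c ≡ extend v x (p ∷ʳ y)) fun (λ {x} {y} {r} i c∈ → key x y {r} c∈)
        (Unique-tail u)
      (λ {x} {y} {r} i → let (ur , _ , y∉ , _) = Unique-pick₂ (Unique-tail u) i in
        Unique-if (adj v x ∧ adj v y) (extend v x) (λ { refl → refl }) (Unique-paths (length r) r x y ur y∉)))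
    (Unique-cycles S (Unique-tail u)) disjoint
    where
    fun : ∀ {c x y x′ y′} → (∃ λ p → c ≡ extend v x (p ∷ʳ y)) → (∃ λ p → c ≡ extend v x′ (p ∷ʳ y′)) → x ≡ x′ ×
        y ≡ y′
    fun (p , refl) (p′ , eq) with ∷-injective (proj₂ (∷-injective eq))
    ... | x≡ , q≡ = x≡ , proj₂ (∷ʳ-injective p p′ q≡)
    key : ∀ x y {r c} → c ∈ (if adj v x ∧ adj v y then map (extend v x) (paths (length r) r x y) else []) →
        ∃ λ p → c ≡ extend v x (p ∷ʳ y)
    key x y {r} c∈ with ∈-map⁻ (extend v x) (proj₂ (∈-if {b = adj v x ∧ adj v y} c∈))
    ... | q , q∈ , refl with Path-last (∈-paths⁻ (length r) r x y q∈)
    ...   | p , refl = p , refl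
    disjoint : ∀ {c} → ¬ (c ∈ cyclesThru v S × c ∈ cycles S)
    disjoint (c∈ , c∈′) with ∈-thru⁻ v S c∈
    ... | x , y , r , q , refl , _ = Unique-head u (Cycle-⊆ (∈-cycles⁻ S c∈′) (here refl))

-- Closed walks as lists, and their edges

module _ {V : Set} where

  -- Link l i j: j comes right after i in l.
  data Link : List V → V → V → Set where
    here  : ∀ {a b l} → Link (a ∷ b ∷ l) a b
    there : ∀ {a l i j} → Link l i j → Link (a ∷ l) i j

  close : List V → List V
  close []      = []
  close (v ∷ t) = v ∷ (t ∷ʳ v)

  Edge : List V → V → V → Set
  Edge c i j = Link (close c) i j ⊎ Link (close c) j i

  Edge-sym : ∀ c {i j} → Edge c i j → Edge c j i
  Edge-sym c = Sum.swap

  Link-∈ : ∀ {l i j} → Link l i j → i ∈ l × j ∈ l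
  Link-∈ here = here refl , there (here refl)
  Link-∈ (there k) = there (proj₁ (Link-∈ k)) , there (proj₂ (Link-∈ k))

  Link-++⁺ˡ : ∀ {xs ys i j} → Link xs i j → Link (xs ++ ys) i j
  Link-++⁺ˡ here = here
  Link-++⁺ˡ (there k) = there (Link-++⁺ˡ k)

  Link-++⁺ʳ : ∀ xs {ys i j} → Link ys i j → Link (xs ++ ys) i j
  Link-++⁺ʳ [] k = k
  Link-++⁺ʳ (x ∷ xs) k = there (Link-++⁺ʳ xs k)

  Link-split : ∀ xs {m ys i j} → Link (xs ++ m ∷ ys) i j → Link (xs ∷ʳ m) i j ⊎ Link (m ∷ ys) i j
  Link-split [] k = inj₂ k
  Link-split (x ∷ []) here = inj₁ here
  Link-split (x ∷ x′ ∷ xs) here = inj₁ here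
  Link-split (x ∷ xs) (there k) = Sum.map there (λ z → z) (Link-split xs k)

  Link-join : ∀ xs {m ys i j} → Link (xs ∷ʳ m) i j ⊎ Link (m ∷ ys) i j → Link (xs ++ m ∷ ys) i j
  Link-join xs {m} {ys} {i} {j} (inj₁ k) = subst (λ l → Link l i j) (++-assoc xs (m ∷ []) ys) (Link-++⁺ˡ k)
  Link-join xs (inj₂ k) = Link-++⁺ʳ xs k

  Link-reverse : ∀ {l i j} → Link l i j → Link (reverse l) j i
  Link-reverse {i ∷ j ∷ l} here = subst (λ m → Link m j i)
    (sym (trans (unfold-reverse i (j ∷ l))
        (trans (cong (_∷ʳ i) (unfold-reverse j l)) (++-assoc (reverse l) (j ∷ []) (i ∷ [])))))
    (Link-++⁺ʳ (reverse l) here)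
  Link-reverse {a ∷ l} {i} {j} (there k) =
      subst (λ m → Link m j i) (sym (unfold-reverse a l)) (Link-++⁺ˡ (Link-reverse k))

  -- Both closed walks consist of the same two pieces, from `a` to `b` and from `b` to `a`, joined
  -- in either order.
  close-++ : ∀ a xs b ys {i j} → Link (close (a ∷ xs ++ b ∷ ys)) i j → Link (close (b ∷ ys ++ a ∷ xs)) i j
  close-++ a xs b ys {i} {j} k = subst (λ l → Link (b ∷ l) i j) (sym (++-assoc ys (a ∷ xs) (b ∷ [])))
    (Link-join (b ∷ ys) (Sum.swap
        (Link-split (a ∷ xs) (subst (λ l → Link (a ∷ l) i j) (++-assoc xs (b ∷ ys) (a ∷ [])) k))))

  Edge-rotate : ∀ a xs b ys {i j} → Edge (a ∷ xs ++ b ∷ ys) i j → Edge (b ∷ ys ++ a ∷ xs) i j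
  Edge-rotate a xs b ys = Sum.map (close-++ a xs b ys) (close-++ a xs b ys)

  close-reverse : ∀ v t → reverse (close (v ∷ t)) ≡ close (v ∷ reverse t)
  close-reverse v t = trans (unfold-reverse v (t ∷ʳ v)) (cong (_∷ʳ v) (reverse-++ t (v ∷ [])))

  Edge-reverse : ∀ v t {i j} → Edge (v ∷ t) i j → Edge (v ∷ reverse t) i j
  Edge-reverse v t {i} {j} e =
      subst (λ l → Link l i j ⊎ Link l j i) (close-reverse v t)
      (Sum.swap (Sum.map Link-reverse Link-reverse e))

  Edge-reverse⁻ : ∀ v t {i j} → Edge (v ∷ reverse t) i j → Edge (v ∷ t) i j
  Edge-reverse⁻ v t {i} {j} e =
      subst (λ l → Edge (v ∷ l) i j) (reverse-involutive t) (Edge-reverse v (reverse t) e)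

  next-unique : ∀ xs {a b d ys z} → b ∉ xs → b ≢ a → b ∉ d ∷ ys → Link (xs ++ a ∷ b ∷ d ∷ ys) b z → z ≡ d
  next-unique [] b∉ b≢a b∉′ here = contradiction refl b≢a
  next-unique [] b∉ b≢a b∉′ (there here) = refl
  next-unique [] b∉ b≢a b∉′ (there (there k)) = contradiction (proj₁ (Link-∈ k)) b∉′
  next-unique (x ∷ []) b∉ b≢a b∉′ here = contradiction (here refl) b∉
  next-unique (x ∷ x′ ∷ xs) b∉ b≢a b∉′ here = contradiction (here refl) b∉
  next-unique (x ∷ xs) b∉ b≢a b∉′ (there k) = next-unique xs (b∉ ∘ there) b≢a b∉′ k

  previous-unique : ∀ xs {a b d ys z} → b ∉ xs → b ≢ a → b ∉ d ∷ ys → Link (xs ++ a ∷ b ∷ d ∷ ys) z b → z ≡ a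
  previous-unique [] b∉ b≢a b∉′ here = refl
  previous-unique [] b∉ b≢a b∉′ (there here) = contradiction (here refl) b∉′
  previous-unique [] b∉ b≢a b∉′ (there (there k)) = contradiction (proj₂ (Link-∈ k)) b∉′
  previous-unique (x ∷ []) b∉ b≢a b∉′ here = contradiction refl b≢a
  previous-unique (x ∷ x′ ∷ xs) b∉ b≢a b∉′ here = contradiction (there (here refl)) b∉
  previous-unique (x ∷ xs) b∉ b≢a b∉′ (there k) = previous-unique xs (b∉ ∘ there) b≢a b∉′ k

  neighbours : ∀ {c} xs {a b d ys z} → close c ≡ xs ++ a ∷ b ∷ d ∷ ys → b ∉ xs → b ≢ a → b ∉ d ∷ ys →
      Edge c b z → z ≡ d ⊎ z ≡ a
  neighbours {c} xs {a} {b} {d} {ys} {z} eq b∉ b≢a b∉′ =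
    Sum.map (next-unique xs b∉ b≢a b∉′ ∘ subst (λ l → Link l b z) eq)
        (previous-unique xs b∉ b≢a b∉′ ∘ subst (λ l → Link l z b) eq)

  first-neighbours : ∀ {v x p y z} → v ∉ x ∷ (p ∷ʳ y) → Edge (v ∷ x ∷ (p ∷ʳ y)) v z → z ≡ x ⊎ z ≡ y
  first-neighbours {v} {x} {p} {y} v∉ e =
      -- Rotating the last vertex `y` to the front puts `v` between `y` and `x`, away from the point
      -- where the walk closes.
      neighbours {y ∷ v ∷ x ∷ p} [] refl (λ ()) (λ { refl → v∉ (there (∈-++⁺ʳ p (here refl))) }) v∉
    (Edge-rotate v (x ∷ p) y [] e)

  next-edge : ∀ {c} xs {b d ys} → close c ≡ xs ++ b ∷ d ∷ ys → Edge c b d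
  next-edge xs {b} {d} eq = inj₁ (subst (λ l → Link l b d) (sym eq) (Link-++⁺ʳ xs here))

  Unique-middle : ∀ xs {b : V} {ys} → Unique (xs ++ b ∷ ys) → b ∉ xs × b ∉ ys
  Unique-middle [] u = (λ ()) , Unique-head u
  Unique-middle (x ∷ xs) {b} {ys} u with Unique-middle xs (Unique-tail u)
  ... | b∉xs , b∉ys = (λ { (here refl) → Unique-head u (∈-++⁺ʳ xs (here refl)) ; (there b∈) → b∉xs b∈ }) ,
      b∉ys

  -- Two closed walks that agree up to the step a → b continue alike: the next vertex is the
  -- neighbour of b other than a, and it is the starting vertex v only at the end.
  continue : ∀ {c c′ v} xs xs′ a b q q′ →
    (∀ {i j} → Edge c i j → Edge c′ i j) → (∀ {i j} → Edge c′ i j → Edge c i j) →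
    c ≡ xs ++ a ∷ b ∷ q → c′ ≡ xs′ ++ a ∷ b ∷ q′ →
    close c ≡ xs ++ a ∷ b ∷ (q ∷ʳ v) → close c′ ≡ xs′ ++ a ∷ b ∷ (q′ ∷ʳ v) →
    v ∈ xs ∷ʳ a → v ∈ xs′ ∷ʳ a → Unique c → Unique c′ → q ≡ q′
  continue {c} {c′} {v} xs xs′ a b q q′ to from refl refl eq eq′ v∈ v∈′ u u′ = go q q′ u u′ eq eq′ to from
    where
    module Side (xs : List V) (q : List V) (u : Unique (xs ++ a ∷ b ∷ q)) (v∈ : v ∈ xs ∷ʳ a) where
      u₂ : Unique ((xs ∷ʳ a) ++ b ∷ q)
      u₂ = subst Unique (sym (++-assoc xs (a ∷ []) (b ∷ q))) u
      b∉ = proj₁ (Unique-middle (xs ∷ʳ a) u₂)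
      b∉xs : b ∉ xs
      b∉xs = b∉ ∘ ∈-++⁺ˡ
      b≢a : b ≢ a
      b≢a refl = b∉ (∈-++⁺ʳ xs (here refl))
      b≢v : b ≢ v
      b≢v refl = b∉ v∈
      b∉q∷ʳv : b ∉ q ∷ʳ v
      b∉q∷ʳv b∈ with ∈-++⁻ q b∈
      ... | inj₁ b∈q = proj₂ (Unique-middle (xs ∷ʳ a) u₂) b∈q
      ... | inj₂ (here b≡v) = b≢v b≡v
      a∉q : a ∉ b ∷ q
      a∉q = proj₂ (Unique-middle xs u)
      v∉q : v ∉ q
      v∉q v∈q with ∈-++⁻ xs v∈
      ... | inj₁ v∈xs = let (ys , zs , eq) = ∈-∃++ v∈xs in
              proj₂ (Unique-middle ys
                  (subst Unique (trans (cong (_++ a ∷ b ∷ q) eq) (++-assoc ys (v ∷ zs) (a ∷ b ∷ q))) u))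
                  (∈-++⁺ʳ zs (there (there v∈q)))
      ... | inj₂ (here refl) = a∉q (there v∈q)
    go : ∀ q q′ → Unique (xs ++ a ∷ b ∷ q) → Unique (xs′ ++ a ∷ b ∷ q′) →
      close (xs ++ a ∷ b ∷ q) ≡ xs ++ a ∷ b ∷ (q ∷ʳ v) →
          close (xs′ ++ a ∷ b ∷ q′) ≡ xs′ ++ a ∷ b ∷ (q′ ∷ʳ v) →
      (∀ {i j} → Edge (xs ++ a ∷ b ∷ q) i j → Edge (xs′ ++ a ∷ b ∷ q′) i j) →
      (∀ {i j} → Edge (xs′ ++ a ∷ b ∷ q′) i j → Edge (xs ++ a ∷ b ∷ q) i j) → q ≡ q′
    go [] [] _ _ _ _ _ _ = refl
    -- One walk closes after `b`, which makes the next vertex `d` of the other equal to `v` or `a`;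
    -- both occur there already.
    go [] (d ∷ q′) u u′ eq eq′ to from
      with neighbours xs eq (Side.b∉xs xs [] u v∈) (Side.b≢a xs [] u v∈) (Side.b∉q∷ʳv xs [] u v∈)
          (from (next-edge (xs′ ∷ʳ a) (trans eq′ (sym (++-assoc xs′ (a ∷ []) _)))))
    ... | inj₁ refl = contradiction (here refl) (Side.v∉q xs′ (d ∷ q′) u′ v∈′)
    ... | inj₂ refl = contradiction (there (here refl)) (Side.a∉q xs′ (d ∷ q′) u′ v∈′)
    go (d ∷ q) [] u u′ eq eq′ to from
      with neighbours xs′ eq′ (Side.b∉xs xs′ [] u′ v∈′) (Side.b≢a xs′ [] u′ v∈′) (Side.b∉q∷ʳv xs′ [] u′ v∈′)
          (to (next-edge (xs ∷ʳ a) (trans eq (sym (++-assoc xs (a ∷ []) _)))))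
    ... | inj₁ refl = contradiction (here refl) (Side.v∉q xs (d ∷ q) u v∈)
    ... | inj₂ refl = contradiction (there (here refl)) (Side.a∉q xs (d ∷ q) u v∈)
    go (d ∷ q) (d′ ∷ q′) u u′ eq eq′ to from
      with neighbours xs eq (Side.b∉xs xs (d ∷ q) u v∈) (Side.b≢a xs (d ∷ q) u v∈)
          (Side.b∉q∷ʳv xs (d ∷ q) u v∈)
          (from (next-edge (xs′ ∷ʳ a) (trans eq′ (sym (++-assoc xs′ (a ∷ []) _)))))
    ... | inj₂ refl = contradiction (there (here refl)) (Side.a∉q xs′ (d′ ∷ q′) u′ v∈′)
    ... | inj₁ refl = cong (d ∷_) (continue (xs ∷ʳ a) (xs′ ∷ʳ a) b d q q′ to from
            (sym (++-assoc xs (a ∷ []) _)) (sym (++-assoc xs′ (a ∷ []) _))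
            (trans eq (sym (++-assoc xs (a ∷ []) _))) (trans eq′ (sym (++-assoc xs′ (a ∷ []) _)))
            (∈-++⁺ˡ v∈) (∈-++⁺ˡ v∈′) u u′)

-- Enumerated cycles and edge sets

Unique-resp-↭ : ∀ {A : Set} {xs ys : List A} → xs ↭ ys → Unique xs → Unique ys
Unique-resp-↭ xs↭ys = Permutationₛ.Unique-resp-↭ (setoid _) (↭⇒↭ₛ xs↭ys)

_≈ᶜ_ : ∀ {V : Set} → List V → List V → Set
c ≈ᶜ c′ = (∀ {i j} → Edge c i j → Edge c′ i j) × (∀ {i j} → Edge c′ i j → Edge c i j)

close-∈ : ∀ {V : Set} (c : List V) {z} → z ∈ close c → z ∈ c
close-∈ (v ∷ t) (here z≡v) = here z≡v
close-∈ (v ∷ t) (there z∈) with ∈-++⁻ t z∈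
... | inj₁ z∈t = there z∈t
... | inj₂ (here z≡v) = here z≡v

Edge-∈ : ∀ {V : Set} {c : List V} {i j} → Edge c i j → i ∈ c
Edge-∈ {c = c} (inj₁ k) = close-∈ c (proj₁ (Link-∈ k))
Edge-∈ {c = c} (inj₂ k) = close-∈ c (proj₂ (Link-∈ k))

rotate-to : ∀ {V : Set} {c : List V} {v} → v ∈ c → ∃ λ t → c ↭ v ∷ t × c ≈ᶜ (v ∷ t)
rotate-to {v = v} v∈ with ∈-∃++ v∈
... | [] , t , refl = t , ↭-refl , id , id
... | a ∷ xs , ys , refl =
    ys ++ a ∷ xs , ++-comm (a ∷ xs) (v ∷ ys) , Edge-rotate a xs v ys , Edge-rotate v ys a xs

last-edge : ∀ {V : Set} (v x : V) p y → Edge (v ∷ x ∷ (p ∷ʳ y)) y v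
last-edge v x p y = inj₁
    (there (there (subst (λ l → Link l y v) (sym (++-assoc p (y ∷ []) (v ∷ []))) (Link-++⁺ʳ p here))))

module _ {V : Set} (adj : V → V → Bool) where

  open Enumeration adj

  Cycle-injective : ∀ {L c c′} → Unique L → Cycle L c → Cycle L c′ → c ≈ᶜ c′ → c ≡ c′
  Cycle-injective u (there k) (there k′) eq = Cycle-injective (Unique-tail u) k k′ eq
  Cycle-injective u (here _ _ _ _) (there k′) (to , _) =
      contradiction (Cycle-⊆ k′ (Edge-∈ (to (inj₁ here)))) (Unique-head u)
  Cycle-injective u (there k) (here _ _ _ _) (_ , from) =
      contradiction (Cycle-⊆ k (Edge-∈ (from (inj₁ here)))) (Unique-head u)
  Cycle-injective {v ∷ S} u k@(here {x = x} {y} i _ _ p) k′@(here {x = x′} {y′} i′ _ _ p′) (to , from)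
    with Path-last p | Path-last p′ | Cycle-Unique u k | Cycle-Unique u k′
  ... | q , refl | q′ , refl | uc | uc′ with first-neighbours (Unique-head uc) (from (inj₁ here))
  ...   | inj₁ refl = cong (λ q → v ∷ x ∷ q)
      (continue [] [] v x _ _ to from refl refl refl refl (here refl) (here refl) uc uc′)
  -- The second list would run backwards, with `x′ = y`. Its last vertex `y′` is then `x`, against
  -- the order of the pair in `S`, or `y`, against `x′ ≢ y′`.
  ...   | inj₂ refl with first-neighbours (Unique-head uc)
      (from (Edge-sym (v ∷ x′ ∷ (q′ ∷ʳ y′)) (last-edge v x′ q′ y′)))
  ...     | inj₁ refl = contradiction i′ (Pick₂-asym (Unique-tail u) i)
  ...     | inj₂ refl = contradiction refl (proj₂ (proj₂ (proj₂ (Unique-pick₂ (Unique-tail u) i′))))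

  walk : ∀ {r y} x p → Unique p → (∀ {z} → z ∈ p → z ∈ r) →
      (∀ {i j} → Link (x ∷ (p ∷ʳ y)) i j → adj i j ≡ true) → Path y r x (p ∷ʳ y)
  walk x [] u ⊆r adj-p = stop (adj-p here)
  walk {r} x (w ∷ p) u ⊆r adj-p with Pick-∈ (⊆r (here refl))
  ... | r′ , i = step i (adj-p here) (walk w p (Unique-tail u) ⊆r′ (adj-p ∘ there))
    where
    ⊆r′ : ∀ {z} → z ∈ p → z ∈ r′
    ⊆r′ z∈ with Pick-other i (⊆r (there z∈))
    ... | inj₁ refl = contradiction z∈ (Unique-head u)
    ... | inj₂ z∈r′ = z∈r′

  Cycle-from-pair : ∀ {v S x y r p} → Pick₂ S x y r → Unique (x ∷ (p ∷ʳ y)) → (∀ {z} → z ∈ p → z ∈ S) →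
    (∀ {i j} → Edge (v ∷ x ∷ (p ∷ʳ y)) i j → adj i j ≡ true) → Cycle (v ∷ S) (v ∷ x ∷ (p ∷ʳ y))
  Cycle-from-pair {v} {S} {x} {y} {r} {p} i u ⊆S adj-c =
      here i (adj-c (inj₁ here)) (adj-c (Edge-sym (v ∷ x ∷ (p ∷ʳ y)) (last-edge v x p y)))
    (walk x p (proj₁ (Unique-pick (Unique-resp-↭ (++-comm p (y ∷ [])) (Unique-tail u)) here)) ⊆r
        (λ k → adj-c (inj₁ (there (Link-++⁺ˡ k)))))
    where
    ⊆r : ∀ {z} → z ∈ p → z ∈ r
    ⊆r z∈ = Pick₂-other i (⊆S z∈) (λ { refl → Unique-head u (∈-++⁺ˡ z∈) })
      (λ { refl → Unique-head (Unique-resp-↭ (++-comm p (y ∷ [])) (Unique-tail u)) z∈ })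

  -- If the last vertex precedes the second one in `S`, the reversed walk is the one enumerated.
  Cycle-complete-here : ∀ {v S} t → Unique (v ∷ t) → 2 ≤ length t → (∀ {z} → z ∈ t → z ∈ S) →
    (∀ {i j} → Edge (v ∷ t) i j → adj i j ≡ true) → ∃ λ c → Cycle (v ∷ S) c × (v ∷ t) ≈ᶜ c
  Cycle-complete-here (x ∷ t) u 2≤ ⊆S adj-c with initLast t
  Cycle-complete-here (x ∷ .[]) u (s≤s ()) ⊆S adj-c | []
  Cycle-complete-here {v} {S} (x ∷ .(p ∷ʳ y)) u 2≤ ⊆S adj-c | p ∷ʳ′ y
    with Pick₂-∈ (⊆S (here refl)) (⊆S (there (∈-++⁺ʳ p (here refl))))
        (λ { refl → Unique-head (Unique-tail u) (∈-++⁺ʳ p (here refl)) })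
  ... | inj₁ (r , i) = v ∷ x ∷ (p ∷ʳ y) , Cycle-from-pair i (Unique-tail u) (⊆S ∘ there ∘ ∈-++⁺ˡ) adj-c , id ,
      id
  ... | inj₂ (r , i) = v ∷ y ∷ (reverse p ∷ʳ x) ,
        Cycle-from-pair i (subst Unique rev (Unique-resp-↭ (↭-sym (↭-reverse t′)) (Unique-tail u)))
          (λ z∈ → ⊆S (there (∈-++⁺ˡ (∈-resp-↭ (↭-reverse p) z∈))))
          (adj-c ∘ Edge-reverse⁻ v t′ ∘ subst (λ t → Edge (v ∷ t) _ _) (sym rev)) ,
        (λ {i} {j} → subst (λ t → Edge (v ∷ t) i j) rev ∘ Edge-reverse v t′) ,
        (λ {i} {j} → Edge-reverse⁻ v t′ ∘ subst (λ t → Edge (v ∷ t) i j) (sym rev))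
    where
    t′ = x ∷ (p ∷ʳ y)
    rev : reverse t′ ≡ y ∷ (reverse p ∷ʳ x)
    rev = trans (unfold-reverse x (p ∷ʳ y)) (cong (_∷ʳ x) (reverse-++ p (y ∷ [])))

  -- `L` is searched for its first vertex on `c`, and `c` is rotated to start there; the rest of `c`
  -- then lies in the rest of `L`.
  Cycle-complete : (∀ (x y : V) → Dec (x ≡ y)) → ∀ L c → Unique c → 3 ≤ length c → (∀ {z} → z ∈ c → z ∈ L) →
    (∀ {i j} → Edge c i j → adj i j ≡ true) → ∃ λ c′ → Cycle L c′ × c ≈ᶜ c′
  Cycle-complete _≟_ [] (x ∷ c) u 3≤ ⊆L adj-c with ⊆L (here refl)
  ... | ()
  Cycle-complete _≟_ (v ∷ S) c u 3≤ ⊆L adj-c with _∈?_ _≟_ v c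
  ... | no v∉ = let (c′ , k , eq) = Cycle-complete _≟_ S c u 3≤ ⊆S adj-c in c′ , there k , eq
    where
    ⊆S : ∀ {z} → z ∈ c → z ∈ S
    ⊆S z∈ with ⊆L z∈
    ... | here refl = contradiction z∈ v∉
    ... | there z∈S = z∈S
  ... | yes v∈ with rotate-to v∈
  ...   | t , c↭ , to , from with Cycle-complete-here {S = S} t u′
      (s≤s⁻¹ (≤-trans 3≤ (≤-reflexive (↭-length c↭)))) ⊆S (adj-c ∘ from)
    where
    u′ = Unique-resp-↭ c↭ u
    ⊆S : ∀ {z} → z ∈ t → z ∈ S
    ⊆S z∈ with ⊆L (∈-resp-↭ (↭-sym c↭) (there z∈))
    ... | here refl = contradiction z∈ (Unique-head u′)
    ... | there z∈S = z∈S
  ...     | c′ , k , to′ , from′ = c′ , k , to′ ∘ to , from ∘ from′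

-- Cycles given by functions on `Fin`

module _ {V : Set} where

  -- `f ∘ cnext` in structural form. The value after the last index is a parameter, because the
  -- recursion on `f ∘ suc` loses the starting vertex.
  successor : ∀ {m} → (Fin (suc m) → V) → V → Fin (suc m) → V
  successor {zero}  f w zero    = w
  successor {suc m} f w zero    = f (suc zero)
  successor {suc m} f w (suc k) = successor (f ∘ suc) w k

  Link-tabulate⁻ : ∀ {m} (f : Fin (suc m) → V) w {i j} → Link (tabulate f ∷ʳ w) i j → ∃ λ k → i ≡ f k ×
      j ≡ successor f w k
  Link-tabulate⁻ {zero} f w here = zero , refl , refl
  Link-tabulate⁻ {zero} f w (there (there ()))
  Link-tabulate⁻ {suc m} f w here = zero , refl , refl
  Link-tabulate⁻ {suc m} f w (there l) with Link-tabulate⁻ (f ∘ suc) w l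
  ... | k , i≡ , j≡ = suc k , i≡ , j≡

  Link-tabulate⁺ : ∀ {m} (f : Fin (suc m) → V) w k → Link (tabulate f ∷ʳ w) (f k) (successor f w k)
  Link-tabulate⁺ {zero} f w zero = here
  Link-tabulate⁺ {suc m} f w zero = here
  Link-tabulate⁺ {suc m} f w (suc k) = there (Link-tabulate⁺ (f ∘ suc) w k)

  successor-last : ∀ {m} (f : Fin (suc m) → V) w k → toℕ k ≡ m → successor f w k ≡ w
  successor-last {zero} f w zero _ = refl
  successor-last {suc m} f w (suc k) e = successor-last (f ∘ suc) w k (suc-injective e)

  successor-next : ∀ {m} (f : Fin (suc m) → V) w k k′ → toℕ k′ ≡ suc (toℕ k) → successor f w k ≡ f k′
  successor-next {zero} f w zero (suc ()) _
  successor-next {suc m} f w zero (suc zero) _ = refl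
  successor-next {suc m} f w (suc k) (suc k′) e = successor-next (f ∘ suc) w k k′ (suc-injective e)

  successor-cnext : ∀ {m} (f : Fin (suc m) → V) k → successor f (f zero) k ≡ f (cnext k)
  successor-cnext {m} f k with toℕ k ≟ m
  ... | yes e = trans (successor-last f (f zero) k e) (cong f (sym (toℕ-injective (trans (toℕ-fromℕ< _)
                  (trans (cong (λ n → suc n % suc m) e) (n%n≡0 (suc m)))))))
  ... | no ¬e = successor-next f (f zero) k (cnext k)
      (trans (toℕ-fromℕ< _) (m<n⇒m%n≡m (s≤s (≤∧≢⇒< (s≤s⁻¹ (toℕ<n k)) ¬e))))

  Edge-tabulate⁻ : ∀ {m} (f : Fin (suc m) → V) {i j} → Edge (tabulate f) i j →
    ∃ λ k → (i ≡ f k × j ≡ f (cnext k)) ⊎ (j ≡ f k × i ≡ f (cnext k))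
  Edge-tabulate⁻ f (inj₁ l) with Link-tabulate⁻ f (f zero) l
  ... | k , i≡ , j≡ = k , inj₁ (i≡ , trans j≡ (successor-cnext f k))
  Edge-tabulate⁻ f (inj₂ l) with Link-tabulate⁻ f (f zero) l
  ... | k , j≡ , i≡ = k , inj₂ (j≡ , trans i≡ (successor-cnext f k))

  Link-cnext : ∀ {m} (f : Fin (suc m) → V) k → Link (close (tabulate f)) (f k) (f (cnext k))
  Link-cnext f k = subst (Link (close (tabulate f)) (f k)) (successor-cnext f k) (Link-tabulate⁺ f (f zero) k)

  Edge-tabulate⁺ : ∀ {m} (f : Fin (suc m) → V) {i j} →
    (∃ λ k → (i ≡ f k × j ≡ f (cnext k)) ⊎ (j ≡ f k × i ≡ f (cnext k))) → Edge (tabulate f) i j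
  Edge-tabulate⁺ f (k , inj₁ (refl , refl)) = inj₁ (Link-cnext f k)
  Edge-tabulate⁺ f (k , inj₂ (refl , refl)) = inj₂ (Link-cnext f k)

  lookup-injective : ∀ {xs : List V} → Unique xs → ∀ {i j} → lookup xs i ≡ lookup xs j → i ≡ j
  lookup-injective {x ∷ xs} u {zero} {zero} e = refl
  lookup-injective {x ∷ xs} u {zero} {suc j} e =
      contradiction (subst (_∈ xs) (sym e) (∈-lookup j)) (Unique-head u)
  lookup-injective {x ∷ xs} u {suc i} {zero} e = contradiction (subst (_∈ xs) e (∈-lookup i)) (Unique-head u)
  lookup-injective {x ∷ xs} u {suc i} {suc j} e = cong suc (lookup-injective (Unique-tail u) e)

module _ {n : ℕ} where

  link? : ∀ (l : List (Fin n)) i j → Dec (Link l i j)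
  link? [] i j = no λ ()
  link? (a ∷ []) i j = no λ { (there ()) }
  link? (a ∷ b ∷ l) i j =
      map′ [ (λ { (refl , refl) → here }) , there ]′ (λ { here → inj₁ (refl , refl) ; (there k) → inj₂ k })
    ((a ≟ᶠ i ×-dec b ≟ᶠ j) ⊎-dec link? (b ∷ l) i j)

  edge? : ∀ (c : List (Fin n)) i j → Dec (Edge c i j)
  edge? c i j = link? (close c) i j ⊎-dec link? (close c) j i

  edgeSet : List (Fin n) → EdgeSet n
  edgeSet c = Vec.tabulate λ i → Vec.tabulate λ j → does (edge? c i j)

  lookup-edgeSet : ∀ c i j → Vec.lookup (Vec.lookup (edgeSet c) i) j ≡ does (edge? c i j)
  lookup-edgeSet c i j =
      trans (cong (λ r → Vec.lookup r j) (Vec.lookup∘tabulate _ i)) (Vec.lookup∘tabulate _ j)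

  ∋-edgeSet⁺ : ∀ c {i j} → Edge c i j → edgeSet c ∋ₑ i , j
  ∋-edgeSet⁺ c {i} {j} e = trans (lookup-edgeSet c i j) (dec-true (edge? c i j) e)

  ∋-edgeSet⁻ : ∀ c {i j} → edgeSet c ∋ₑ i , j → Edge c i j
  ∋-edgeSet⁻ c {i} {j} e with edge? c i j in eq
  ... | yes k = k
  ... | no ¬k = contradiction (trans (sym e) (trans (lookup-edgeSet c i j) (cong does eq))) λ ()

  ∋-ext : ∀ {H H′ : EdgeSet n} → (∀ {i j} → H ∋ₑ i , j → H′ ∋ₑ i , j) → (∀ {i j} → H′ ∋ₑ i , j → H ∋ₑ i , j) →
      H ≡ H′
  ∋-ext {H} {H′} to from = trans (sym (Vec.tabulate∘lookup H)) (trans (Vec.tabulate-cong λ i →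
    trans (sym (Vec.tabulate∘lookup _))
        (trans (Vec.tabulate-cong λ j → bool _ _ to from) (Vec.tabulate∘lookup _))) (Vec.tabulate∘lookup H′))
    where
    bool : ∀ a b → (a ≡ true → b ≡ true) → (b ≡ true → a ≡ true) → a ≡ b
    bool true b t f = sym (t refl)
    bool false true t f = f refl
    bool false false t f = refl

  edgeSet-≈ : ∀ {c c′} → edgeSet c ≡ edgeSet c′ → c ≈ᶜ c′
  edgeSet-≈ {c} {c′} eq = (λ {i} {j} → ∋-edgeSet⁻ c′ ∘ subst (_∋ₑ i , j) eq ∘ ∋-edgeSet⁺ c) ,
                          (λ {i} {j} → ∋-edgeSet⁻ c ∘ subst (_∋ₑ i , j) (sym eq) ∘ ∋-edgeSet⁺ c′)

  IsCycle-edgeSet : ∀ c → Unique c → 3 ≤ length c → IsCycle (edgeSet c)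
  IsCycle-edgeSet c@(_ ∷ _ ∷ _ ∷ t) u (s≤s (s≤s (s≤s z≤n))) =
      length t , lookup c , lookup-injective u , λ i j → mk⇔
    (λ e → Edge-tabulate⁻ (lookup c) (subst (λ l → Edge l i j) (sym (tabulate-lookup c)) (∋-edgeSet⁻ c e)))
    (λ k → ∋-edgeSet⁺ c (subst (λ l → Edge l i j) (tabulate-lookup c) (Edge-tabulate⁺ (lookup c) k)))

module _ {n : ℕ} (G : Graph n) where

  open Paths (adj G)
  open Enumeration (adj G)

  Cycle-adj : ∀ {L c} → Cycle L c → ∀ {i j} → Edge c i j → adj G i j ≡ true
  Cycle-adj k (inj₁ l) = Cycle-link k l
    where
    Path-link : ∀ {y S x q i j} → Path y S x q → Link (x ∷ q) i j → adj G i j ≡ true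
    Path-link (stop xy) here = xy
    Path-link (stop xy) (there (there ()))
    Path-link (step _ xu _) here = xu
    Path-link (step _ _ p) (there l) = Path-link p l
    Cycle-link : ∀ {L c i j} → Cycle L c → Link (close c) i j → adj G i j ≡ true
    Cycle-link (there k) l = Cycle-link k l
    Cycle-link (here _ vx _ _) here = vx
    Cycle-link (here {x = x} _ vx vy p) (there l) with Path-last p
    ... | q , refl with Link-split (x ∷ q) (subst (λ m → Link (x ∷ m) _ _) (++-assoc q _ _) l)
    ...   | inj₁ l′ = Path-link p l′
    ...   | inj₂ here = trans (adj-sym G _ _) vy
    ...   | inj₂ (there (there ()))
  Cycle-adj k (inj₂ l) = trans (adj-sym G _ _) (Cycle-adj k (inj₁ l))

  Cycle-length : ∀ {L c} → Cycle L c → 3 ≤ length c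
  Cycle-length (there k) = Cycle-length k
  Cycle-length (here _ _ _ (stop _)) = ≤-refl
  Cycle-length (here _ _ _ (step _ _ _)) = s≤s (s≤s (s≤s z≤n))

  -- Completeness of the enumeration: every edge set in `Hs` is that of some enumerated list, and
  -- `Hs` has no repetitions.
  numCycles-≤ : ∀ {c} → NumCycles G c → ∀ L → (∀ i → i ∈ L) → c ≤ cycleCount L
  numCycles-≤ {c} (Hs , u , refl , spec) L covers = ≤-trans (length-⊆ u ⊆cycles)
    (≤-reflexive (trans (length-map edgeSet (cycles L)) (length-cycles L)))
    where
    ⊆cycles : ∀ {H} → H ∈ Hs → H ∈ map edgeSet (cycles L)
    ⊆cycles {H} H∈ with Equivalence.to (spec H) H∈
    ... | H⊆G , p , f , inj , edges
      with Cycle-complete (adj G) _≟ᶠ_ L (tabulate f) (Unique.tabulate⁺ inj) (s≤s (s≤s (s≤s z≤n)))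
          (λ _ → covers _)
             (λ {i} {j} e → H⊆G i j (Equivalence.from (edges i j) (Edge-tabulate⁻ f e)))
    ...   | c′ , k , to , from = subst (_∈ map edgeSet (cycles L)) (∋-ext
              (λ {i} {j} h → Equivalence.from (edges i j) (Edge-tabulate⁻ f (from (∋-edgeSet⁻ c′ h))))
              (λ {i} {j} h → ∋-edgeSet⁺ c′ (to (Edge-tabulate⁺ f (Equivalence.to (edges i j) h)))))
            (∈-map⁺ edgeSet (∈-cycles⁺ k))

  -- Soundness of the enumeration: every enumerated list gives a cycle of `G`, and distinct lists
  -- give distinct edge sets by `Cycle-injective`.
  numCycles-≥ : ∀ {c} → NumCycles G c → ∀ L → Unique L → cycleCount L ≤ c
  numCycles-≥ {c} (Hs , u , refl , spec) L uL =
      ≤-trans (≤-reflexive (sym (trans (length-map edgeSet (cycles L)) (length-cycles L))))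
    (length-⊆ (Unique-map edgeSet (Unique-cycles L uL) λ a∈ b∈ eq →
        Cycle-injective (adj G) uL (∈-cycles⁻ L a∈) (∈-cycles⁻ L b∈) (edgeSet-≈ eq)) ⊆Hs)
    where
    ⊆Hs : ∀ {H} → H ∈ map edgeSet (cycles L) → H ∈ Hs
    ⊆Hs H∈ with ∈-map⁻ edgeSet H∈
    ... | c′ , c′∈ , refl =
        Equivalence.from (spec _)
        ((λ i j h → Cycle-adj k (∋-edgeSet⁻ c′ h)) , IsCycle-edgeSet c′ (Cycle-Unique uL k) (Cycle-length k))
      where k = ∈-cycles⁻ L c′∈

-- The extremal graph

n/2≡⌊n/2⌋ : ∀ n → n / 2 ≡ ⌊ n /2⌋
n/2≡⌊n/2⌋ 0 = refl
n/2≡⌊n/2⌋ 1 = refl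
n/2≡⌊n/2⌋ (suc (suc n)) = trans (m/n≡1+[m∸n]/n {2 + n} {2} (s≤s (s≤s z≤n))) (cong suc (n/2≡⌊n/2⌋ n))

count-tabulate : ∀ {A : Set} n k (f : Fin n → A) p → (∀ i → p (f i) ≡ (toℕ i <ᵇ k)) → k ≤ n →
    count p (tabulate f) ≡ k
count-tabulate zero    zero    f p h z≤n = refl
count-tabulate (suc n) zero    f p h _ rewrite h zero = count-tabulate n zero (f ∘ suc) p (h ∘ suc) z≤n
count-tabulate (suc n) (suc k) f p h (s≤s k≤n) rewrite h zero =
    cong suc (count-tabulate n k (f ∘ suc) p (h ∘ suc) k≤n)

count-inA : ∀ n → count (inA n) (allFin n) ≡ ⌊ n /2⌋
count-inA n = trans (count-tabulate n (n / 2) id (inA n) (λ _ → refl)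
    (≤-trans (≤-reflexive (n/2≡⌊n/2⌋ n)) (⌊n/2⌋≤n n))) (n/2≡⌊n/2⌋ n)

↭-sorted : ∀ {A : Set} {n} (f : Fin n → A) p →
    tabulate (p ∘ f) ↭ replicate (count p (tabulate f)) true ++ replicate (count (not ∘ p) (tabulate f)) false
↭-sorted {n = zero} f p = ↭-refl
↭-sorted {n = suc n} f p with p (f zero)
... | true  = prep true (↭-sorted (f ∘ suc) p)
... | false = ↭-trans (prep false (↭-sorted (f ∘ suc) p))
    (↭-sym (shift false (replicate (count p (tabulate (f ∘ suc))) true) _))

-- With equal counts, both lists of colours sort to the same list, `true` before `false`; `σ` is the
-- permutation of positions contained in the resulting `↭`.
recolour : ∀ {n} (χ ψ : Fin n → Bool) → count χ (allFin n) ≡ count ψ (allFin n) → ∃ λ (σ : Permutation n n) →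
    ∀ i → χ i ≡ ψ (σ ⟨$⟩ʳ i)
recolour {n} χ ψ eq = (cast-id (sym (length-tabulate χ)) ∘ₚ π ∘ₚ cast-id (length-tabulate ψ)) , agree
  where
  count-not′ : count (not ∘ χ) (allFin n) ≡ count (not ∘ ψ) (allFin n)
  count-not′ = +-cancelˡ-≡ (count χ (allFin n)) _ _
      (trans (count-not χ (allFin n)) (trans (sym (count-not ψ (allFin n))) (cong (_+ _) (sym eq))))
  χ↭ψ : tabulate χ ↭ tabulate ψ
  χ↭ψ = ↭-trans (↭-sorted id χ) (↭-trans
    (subst₂ (λ t f → _ ↭ replicate t true ++ replicate f false) eq count-not′ ↭-refl) (↭-sym (↭-sorted id ψ)))
  π = onIndices (↭⇒↭ₛ χ↭ψ)
  open ≡-Reasoning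
  agree : ∀ i → χ i ≡ ψ (cast (length-tabulate ψ) (π ⟨$⟩ʳ cast (sym (length-tabulate χ)) i))
  agree i = begin
    χ i                            ≡⟨ lookup-tabulate χ i ⟨
    lookup (tabulate χ) i′         ≡⟨ Permutationₛ.onIndices-lookup (setoid Bool) (↭⇒↭ₛ χ↭ψ) i′ ⟩
    lookup (tabulate ψ) j′
        ≡⟨ cong (lookup (tabulate ψ)) (cast-involutive (sym (length-tabulate ψ)) (length-tabulate ψ) j′) ⟨
    lookup (tabulate ψ) (cast (sym (length-tabulate ψ)) (cast (length-tabulate ψ) j′))
        ≡⟨ lookup-tabulate ψ (cast (length-tabulate ψ) j′) ⟩
    ψ (cast (length-tabulate ψ) j′) ∎
    where
    i′ = cast (sym (length-tabulate χ)) i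
    j′ = π ⟨$⟩ʳ i′

not-xor-not : ∀ a b → not a xor not b ≡ a xor b
not-xor-not true  true  = refl
not-xor-not true  false = refl
not-xor-not false true  = refl
not-xor-not false false = refl

balanced-≅ : ∀ {n} (G : Graph n) χ → (∀ i j → adj G i j ≡ χ i xor χ j) → count χ (allFin n) ≡ ⌊ n /2⌋ →
    G ≅ balancedBipartite n
balanced-≅ {n} G χ complete half with recolour χ (inA n) (trans half (sym (count-inA n)))
... | σ , agree = σ , λ i j → trans (complete i j) (cong₂ _xor_ (agree i) (agree j))

cycles-balanced : ∀ {n c} → NumCycles (balancedBipartite n) c → κ-bal n ≤ 2 * c
cycles-balanced {n} {c} N = begin
  κ-bal n                                        ≡⟨ κ-bal≡ n ⟩
  κ ⌈ n /2⌉ ⌊ n /2⌋                              ≡⟨ κ-sym ⌈ n /2⌉ ⌊ n /2⌋ ⟩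
  κ ⌊ n /2⌋ ⌈ n /2⌉                              ≡⟨ cong₂ κ (count-inA n) rest ⟨
  κ (count (inA n) (allFin n)) (count (not ∘ inA n) (allFin n))
      ≡⟨ Bipartite.cycleCount-bipartite (inA n) (allFin n) ⟨
  2 * Paths.cycleCount (adj (balancedBipartite n)) (allFin n)
      ≤⟨ *-monoʳ-≤ 2 (numCycles-≥ (balancedBipartite n) N (allFin n) (Unique.allFin⁺ n)) ⟩
  2 * c                                           ∎
  where
  open ≤-Reasoning
  rest : count (not ∘ inA n) (allFin n) ≡ ⌈ n /2⌉
  rest = +-cancelˡ-≡ ⌊ n /2⌋ _ _ (trans (cong (_+ count (not ∘ inA n) (allFin n)) (sym (count-inA n)))
    (trans (count-not (inA n) (allFin n)) (trans (length-tabulate id) (sym (⌊n/2⌋+⌈n/2⌉≡n n)))))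

-- Comparison with the balanced graph

module _ {n} (G : Graph n) (tf : TriangleFree G) where

  adj-symm : ∀ x y → adj G x y ≡ true → adj G y x ≡ true
  adj-symm x y xy = trans (adj-sym G y x) xy

  adj⇒≢ : ∀ {x y} → adj G x y ≡ true → x ≢ y
  adj⇒≢ {x} xy refl = contradiction (trans (sym xy) (irrefl G x)) λ ()

  no-triangle : ∀ x y z → adj G x y ≡ true → adj G y z ≡ true → adj G x z ≡ false
  no-triangle x y z xy yz = ¬-not λ xz → tf (x , y , z , adj⇒≢ xy , adj⇒≢ yz , adj⇒≢ xz , xy , yz , xz)

  open Extremal (adj G) adj-symm no-triangle
  open Dichotomy (adj G) adj-symm no-triangle
  open Paths (adj G)

  fewer-cycles : ∀ {c cK} → NumCycles G c → NumCycles (balancedBipartite n) cK →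
    (∃ λ L → L ↭ allFin n × 2 * cycleCount L < κ-bal (length L)) → c < cK
  fewer-cycles {c} {cK} N NK (L , L↭ , cyc<) = *-cancelˡ-< 2 c cK (begin-strict
    2 * c              ≤⟨ *-monoʳ-≤ 2 (numCycles-≤ G N L (λ i → ∈-resp-↭ (↭-sym L↭) (∈-allFin i))) ⟩
    2 * cycleCount L          <⟨ cyc< ⟩
    κ-bal (length L)  ≡⟨ cong κ-bal (trans (↭-length L↭) (length-tabulate {n = n} id)) ⟩
    κ-bal n           ≤⟨ cycles-balanced NK ⟩
    2 * cK             ∎)
    where open ≤-Reasoning

  -- Equality excludes a vertex of low degree, so there is a bipartition. It also excludes a missing
  -- edge between the parts and forces the part sizes to be optimal, hence balanced.
  extremal : 6 ≤ n → ∀ {c cK} → NumCycles G c → NumCycles (balancedBipartite n) cK → c ≤ cK ×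
      (c ≡ cK → G ≅ balancedBipartite n)
  extremal 6≤n {c} {cK} N NK with dichotomy (allFin n)
  ... | inj₁ low = <⇒≤ c<cK , λ c≡cK → contradiction c≡cK (<⇒≢ c<cK)
    where c<cK = fewer-cycles N NK
              (non-bipartite-< (allFin n) (≤-trans 6≤n (≤-reflexive (sym (length-tabulate id)))) low)
  ... | inj₂ (χ , proper) = *-cancelˡ-≤ 2 (≤-trans 2c≤ (≤-trans κ≤ (cycles-balanced NK))) , unique
    where
    a = count χ (allFin n)
    b = count (not ∘ χ) (allFin n)
    a+b : a + b ≡ n
    a+b = trans (count-not χ (allFin n)) (length-tabulate id)
    2c≤ : 2 * c ≤ κ a b
    2c≤ = ≤-trans (*-monoʳ-≤ 2 (numCycles-≤ G N (allFin n) ∈-allFin)) (proper-cyc {χ} proper)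
    κ≤ : κ a b ≤ κ-bal n
    κ≤ = ≤-trans (κ-max a b) (≤-reflexive (cong κ-bal a+b))
    complete : c ≡ cK → ∀ i j → adj G i j ≡ χ i xor χ j
    complete c≡cK i j with adj G i j in ij | χ i xor χ j in χij
    ... | true  | true  = refl
    ... | false | false = refl
    ... | true  | false = contradiction (trans (sym χij) (proper (∈-allFin i) (∈-allFin j) ij)) λ ()
    ... | false | true  = contradiction c≡cK (<⇒≢ (fewer-cycles N NK
          (missing-edge-< {χ} (allFin n) (≤-trans 6≤n (≤-reflexive (sym (length-tabulate id)))) proper
              (∈-allFin i) (∈-allFin j) χij ij)))
    unique : c ≡ cK → G ≅ balancedBipartite n
    unique c≡cK with κ-max-unique a b (≤-trans (≤-trans (m≤n+m 4 2) 6≤n) (≤-reflexive (sym a+b)))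
                      (≤-trans (≤-reflexive (cong κ-bal a+b))
                          (≤-trans (cycles-balanced NK) (≤-trans (≤-reflexive (cong (2 *_) (sym c≡cK))) 2c≤)))
    ... | inj₂ half = balanced-≅ G χ (complete c≡cK) (trans half (cong ⌊_/2⌋ a+b))
    -- `inA` marks the part of size `⌊ n /2⌋`, which here is the colour class of `false`, so the
    -- colours are swapped.
    ... | inj₁ half = balanced-≅ G (not ∘ χ)
        (λ i j → trans (complete c≡cK i j) (sym (not-xor-not (χ i) (χ j)))) (trans half (cong ⌊_/2⌋ a+b))

theorem10 : Σ ℕ λ n₀ → 0 < n₀ ×
    (∀ n → n₀ ≤ n → (G : Graph n) → TriangleFree G →
    ∀ c cK → NumCycles G c → NumCycles (balancedBipartite n) cK →
    c ≤ cK × (c ≡ cK → G ≅ balancedBipartite n))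
-- Six vertices leave five after one deletion, where `gain-bound-<` is strict, and give two balanced
-- parts of at least three vertices each.
theorem10 = 6 , s≤s z≤n , λ n 6≤n G tf c cK N NK → extremal G tf 6≤n N NK
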